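{- Let $1 \leq J \leq N$ and $M \geq 1$ be integers, and let $\Omega \subseteq \mathbb{Z}^N$ be a sublattice of rank $J$. Let $\Lambda_1,\dots,\Lambda_M$ be non-zero sublattices of $\Omega$ whose ranks $l_1,\dots,l_M$ satisfy $1 \leq l_i \leq J-1$ for each $1 \leq i \leq M$. Then there exists $\boldsymbol{x} \in \Omega \setminus \bigcup_{i=1}^M \Lambda_i$ such that $$H(\boldsymbol{x}) \leq \left( \left( \frac{3}{2} \right)^{J-1} J^J \left\{ \sum_{i=1}^M \frac{1}{H(\Lambda_i)} + \sqrt{M} \right\} + J \right) H(\Omega).$$
   Context: For $\boldsymbol{x}=(x_1,\dots,x_N)\in\mathbb{Z}^N$, the height is $H(\boldsymbol{x})=\max_{1\leq i\leq N}|x_i|$. A lattice (sublattice) of rank $J$ in $\mathbb{Z}^N$ is a subgroup of $\mathbb{Z}^N$ that is free of rank $J$. For a lattice $\Lambda\subseteq\mathbb{Z}^N$ of rank $J$, $1\leq J\leq N$, choose a $\mathbb{Z}$-basis $\boldsymbol{x}_1,\dots,\boldsymbol{x}_J$ and let $X=(\boldsymbol{x}_1\ \dots\ \boldsymbol{x}_J)$ be the $N\times J$ basis matrix. For each subset $I\subseteq\{1,\dots,N\}$ of cardinality $J$ let $X_I$ be the $J\times J$ submatrix formed by the rows of $X$ indexed by $I$. The height of the lattice is $H(\Lambda)=\max_{I}|\det(X_I)|$, which does not depend on the choice of basis. -}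

module Defs where

open import Algebra.Definitions.RawMonoid using (sum)
import Algebra.Definitions.RawSemiring as RawSemiringDefs
open import Data.Fin using (Fin; zero; suc; punchIn)
open import Data.Integer as ℤ using (ℤ; +_; 0ℤ; 1ℤ; ∣_∣)
open import Data.List as List using (List)
open import Data.Nat as ℕ using (ℕ; zero; suc)
open import Data.Product using (_×_; ∃)
open import Data.Rational as ℚ using (ℚ; 0ℚ)
open import Data.Vec.Functional using (Vector; []; _∷_; foldr; map)
open import Level using (0ℓ)
open import Relation.Binary.PropositionalEquality using (_≡_; _≗_)
open import Relation.Unary using (Pred; _∈_)

∑ℤ : ∀ {n} → Vector ℤ n → ℤ
∑ℤ = sum ℤ.+-0-rawMonoid

∑ℚ : ∀ {n} → Vector ℚ n → ℚ
∑ℚ = sum ℚ.+-0-rawMonoid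

infixr 8 _^ℚ_
_^ℚ_ : ℚ → ℕ → ℚ
_^ℚ_ = RawSemiringDefs._^_ ℚ.+-*-rawSemiring

fromℕ : ℕ → ℚ
fromℕ n = + n ℚ./ 1

-- 1/n, with the junk value 0 at n = 0.  It is applied only to heights of
-- lattices, which are positive because the basis columns are independent.
recip : ℕ → ℚ
recip zero    = 0ℚ
recip (suc n) = + 1 ℚ./ suc n

-- √m ≤ r for rational r.  Since √m is the infimum of all such r, a rational q
-- and a nonnegative rational a satisfy q ≤ a·√m + b over the reals iff
-- q ≤ a·r + b for every r with √m ≤ r.
√_≤_ : ℕ → ℚ → Set
√ m ≤ r = 0ℚ ℚ.≤ r × fromℕ m ℚ.≤ r ℚ.* r

-- Vectors in ℤᴺ are functions Fin N → ℤ, compared by pointwise equality _≗_.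

maximum : ∀ {n} → Vector ℕ n → ℕ
maximum = foldr ℕ._⊔_ 0

height : ∀ {N} → Vector ℤ N → ℕ
height x = maximum (map ∣_∣ x)

-- An m × n matrix, accessed as A row column.
Matrix : ℕ → ℕ → Set
Matrix m n = Fin m → Fin n → ℤ

sign : ∀ {n} → Fin n → ℤ
sign zero    = 1ℤ
sign (suc j) = ℤ.- sign j

-- Laplace expansion along the first row.
det : ∀ {n} → Matrix n n → ℤ
det {zero}  A = 1ℤ
det {suc n} A =
  ∑ℤ λ j → sign j ℤ.* A zero j ℤ.* det (λ i k → A (suc i) (punchIn j k))

-- The J-element subsets of Fin N, each represented once, by the strictly
-- increasing map Fin J → Fin N that lists its elements.
subsets : ∀ J N → List (Fin J → Fin N)
subsets zero    N       = List.[ [] ]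
subsets (suc J) zero    = List.[]
subsets (suc J) (suc N) =
  List.map (λ I → zero ∷ map suc I) (subsets J N)
    List.++ List.map (map suc) (subsets (suc J) N)

-- The maximum of |det X_I| over all J-element sets I of rows.
matrixHeight : ∀ {N J} → Matrix N J → ℕ
matrixHeight {N} {J} X =
  List.foldr ℕ._⊔_ 0 (List.map (λ I → ∣ det (λ i → X (I i)) ∣) (subsets J N))

_·_ : ∀ {N J} → Matrix N J → Vector ℤ J → Vector ℤ N
(X · c) i = ∑ℤ λ j → X i j ℤ.* c j

record IsSubgroup {N} (Λ : Pred (Vector ℤ N) 0ℓ) : Set where
  field
    resp     : ∀ {x y} → x ≗ y → x ∈ Λ → y ∈ Λ
    0-closed : (λ _ → 0ℤ) ∈ Λ
    +-closed : ∀ {x y} → x ∈ Λ → y ∈ Λ → (λ i → x i ℤ.+ y i) ∈ Λ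
    -‿closed : ∀ {x} → x ∈ Λ → (λ i → ℤ.- x i) ∈ Λ

-- The columns of X form a ℤ-basis of Λ.
record IsBasis {N J} (Λ : Pred (Vector ℤ N) 0ℓ) (X : Matrix N J) : Set where
  field
    members     : ∀ j → (λ i → X i j) ∈ Λ
    spanning    : ∀ {x} → x ∈ Λ → ∃ λ c → x ≗ X · c
    independent : ∀ c → X · c ≗ (λ _ → 0ℤ) → c ≗ (λ _ → 0ℤ)

-- The basis is part of the data, so a statement about all lattices is a
-- statement about all lattices and all choices of their bases.
record Lattice (N J : ℕ) : Set₁ where
  field
    carrier    : Pred (Vector ℤ N) 0ℓ
    isSubgroup : IsSubgroup carrier
    basis      : Matrix N J
    isBasis    : IsBasis carrier basis

open Lattice public using (carrier)

latticeHeight : ∀ {N J} → Lattice N J → ℕ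
latticeHeight Λ = matrixHeight (Lattice.basis Λ)

module Submission where

-- Let H = H(Ω).  Choose rows I for which the minor of Ω is maximal, and reduce the
-- basis by unimodular column operations so that these rows become lower
-- triangular; the diagonal entries a₁, …, a_J have product ± H.  By Cramer's rule
-- and maximality every coordinate of a point of Ω is a combination of its J
-- coordinates in I with coefficients in [-1 , 1].  Choosing coefficients one
-- after another, Ω has at least (2kH)^J / H points whose I-coordinates are at
-- most kH, and all of these have height at most T = JkH.  For a lattice Λ of rank
-- l the same triangular shape allows at most ∏ (⌊2T / aⱼ⌋ + 1)
-- ≤ (2T / H(Λ) + 1) (2T + 1)^(l - 1) points of height at most T.  Take the least k
-- for which these counts give Ω more points than all the Λᵢ together: the counts
-- fail for k - 1, which is therefore at most (3J/2)^(J-1) (∑ 1/H(Λᵢ) + √M).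

open import Defs
open import Algebra.Bundles using (CommutativeRing)
open import Data.Fin as Fin using (Fin; zero; suc; punchIn; punchOut; inject₁)
import Data.Fin.Properties as Fin
open import Data.Integer as ℤ using (ℤ)
import Data.Integer.DivMod as ℤ
import Data.Integer.Properties as ℤ
import Data.Integer.Tactic.RingSolver as ℤRing
open import Data.List as List using (List; []; _∷_)
import Data.List.Membership.DecPropositional as DecMembership
open import Data.List.Membership.Propositional using (find; lose) renaming (_∈_ to _∈ₗ_; _∉_ to _∉ₗ_)
open import Data.List.Membership.Propositional.Properties
  using (∈-map⁺; ∈-map⁻; ∈-++⁺ˡ; ∈-++⁺ʳ; ∈-++⁻; ∈-concatMap⁺; ∈-concatMap⁻; ∈-upTo⁺; ∈-upTo⁻; ∈-∃++; foldr-selective)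
open import Data.List.Properties using (foldr-preservesᵒ; length-++; length-map; length-upTo; map-cong)
open import Data.List.Relation.Unary.All as All using (All; []; _∷_)
import Data.List.Relation.Unary.All.Properties as All
open import Data.List.Relation.Unary.AllPairs as AllPairs using ([]; _∷_)
import Data.List.Relation.Unary.AllPairs.Properties as AllPairs
open import Data.List.Relation.Unary.Any as Any using (here; there)
open import Data.List.Relation.Unary.Unique.Propositional using (Unique)
import Data.List.Relation.Unary.Unique.Propositional.Properties as Unique
open import Data.Nat as ℕ using (ℕ; zero; suc)
import Data.Nat.DivMod as ℕ
import Data.Nat.Divisibility as ℕ
open import Data.Nat.Induction using (<-wellFounded)
import Data.Nat.Properties as ℕ
import Data.Nat.Tactic.RingSolver as ℕRing
open import Data.Product using (_×_; ∃; ∃₂; _,_; proj₁; proj₂)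
open import Data.Rational as ℚ using (0ℚ; 1ℚ; toℚᵘ)
import Data.Rational.Properties as ℚ
import Data.Rational.Solver as ℚ
import Data.Rational.Unnormalised as ℚᵘ
import Data.Rational.Unnormalised.Properties as ℚᵘ
open import Data.Sum using (_⊎_; inj₁; inj₂; [_,_]′)
open import Data.Unit using (⊤; tt)
open import Data.Vec as Vec using (Vec; []; _∷_)
open import Data.Vec.Functional as Vector using (Vector; tail; updateAt)
open import Data.Vec.Functional.Properties using (updateAt-updates; updateAt-minimal; map-updateAt)
import Data.Vec.Properties as Vec
open import Function using (_∘_; const)
open import Induction.WellFounded using (Acc; acc)
open import Level using (0ℓ)
open import Relation.Binary.Definitions using (DecidableEquality)
open import Relation.Binary.PropositionalEquality hiding (J; resp)
open import Relation.Nullary using (¬_; ¬?; Dec; yes; no; contradiction)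
open import Relation.Nullary.Decidable using (decidable-stable)
open import Relation.Unary using (Pred; _∈_; _∉_; _⊆_)

-- The point must serve every rational `r` with √M ≤ `r` at once, so it cannot depend on `r`. Hence
-- k is chosen by a decidable inequality, `Outnumbers`, in which M itself occurs. Only afterwards
-- does M ≤ r² turn the failure at k - 1 into a bound for each `r`.
--
-- The box in the rows I has half-side a multiple of H because every aⱼ divides H: each 2kH / aⱼ is
-- then an integer, and no point is lost to rounding. For the Λᵢ rounding costs at most 1 per
-- factor. Among diagonals with a given product the resulting bound is worst when one entry carries
-- the whole product and the others are 1, so H(Λᵢ) appears in a single factor.
--
-- The 3/2 comes from 2T + 1 ≤ 3T = (3J/2) 2kH. The summand 1 next to 2T / H(Λᵢ) adds up to M;
-- weighed against the quadratic (2k)², it costs only √M. The final + J is the price of passing from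
-- k - 1 to k.
--
-- The height is a maximum over increasing row selections, while Cramer's rule replaces one row in
-- place. The determinant must therefore be shown to alternate in its rows; column operations yield
-- this.

module IntegerLattices where

  open import Data.Integer using (0ℤ; 1ℤ; ∣_∣; _+_; _*_; -_)
  open import Data.Integer.Tactic.RingSolver using (solve-∀)
  open import Algebra.Properties.AbelianGroup ℤ.+-0-abelianGroup using ()
    renaming (∙-cancelʳ to +-cancelʳ; x∙y⁻¹≈ε⇒x≈y to x-y≡0⇒x≡y)
  open import Algebra.Properties.Semiring.Sum ℤ.+-*-semiring
    using (sum-cong-≗; ∑-distrib-+; ∑-comm; *-distribˡ-sum; *-distribʳ-sum)
  open ≡-Reasoning

  -- Multilinearity of the determinant

  ∑-zero : ∀ {n} {f : Vector ℤ n} → (∀ j → f j ≡ 0ℤ) → ∑ℤ f ≡ 0ℤ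
  ∑-zero {zero}  f≡0 = refl
  ∑-zero {suc n} f≡0 = cong₂ _+_ (f≡0 zero) (∑-zero (f≡0 ∘ suc))

  ∑-linear : ∀ {n} t (f g : Vector ℤ n) → ∑ℤ (λ j → f j + t * g j) ≡ ∑ℤ f + t * ∑ℤ g
  ∑-linear t f g =
    trans (∑-distrib-+ f (λ j → t * g j)) (cong (∑ℤ f +_) (sym (*-distribˡ-sum t g)))

  ∑-single : ∀ {n} (p : Fin n) {f : Vector ℤ n} → (∀ j → j ≢ p → f j ≡ 0ℤ) → ∑ℤ f ≡ f p
  ∑-single zero    {f} f≡0 = trans (cong (f zero +_) (∑-zero λ j → f≡0 (suc j) λ ())) (ℤ.+-identityʳ _)
  ∑-single (suc p) f≡0 =
    trans (cong₂ _+_ (f≡0 zero λ ()) (∑-single p λ j j≢p → f≡0 (suc j) (j≢p ∘ Fin.suc-injective)))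
          (ℤ.+-identityˡ _)

  infix 4 _≋_
  _≋_ : ∀ {m n} → Matrix m n → Matrix m n → Set
  A ≋ B = ∀ i j → A i j ≡ B i j

  minor : ∀ {n} → Fin (suc n) → Matrix (suc n) (suc n) → Matrix n n
  minor j A i k = A (suc i) (punchIn j k)

  det-cong : ∀ {n} {A B : Matrix n n} → A ≋ B → det A ≡ det B
  det-cong {zero}  A≋B = refl
  det-cong {suc n} A≋B = sum-cong-≗ λ j →
    cong₂ (λ a d → sign j * a * d) (A≋B zero j) (det-cong λ i k → A≋B (suc i) (punchIn j k))

  -- Row zero enters the Laplace expansion linearly; any other row is a row of every minor. Three
  -- matrices that agree off row `p`, rather than updates of one matrix, make the hypotheses pass
  -- directly to minors.
  det-row-linear : ∀ {n} p t {A B C : Matrix n n} →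
    (∀ i → i ≢ p → A i ≗ C i) → (∀ i → i ≢ p → B i ≗ C i) →
    (∀ j → C p j ≡ A p j + t * B p j) →
    det C ≡ det A + t * det B
  det-row-linear {suc n} zero t {A} {B} {C} A≈C B≈C Cₚ = begin
    det C ≡⟨ sum-cong-≗ step ⟩
    ∑ℤ (λ j → α j + t * β j) ≡⟨ ∑-linear t α β ⟩
    det A + t * det B ∎
    where
    α β : Vector ℤ (suc n)
    α j = sign j * A zero j * det (minor j A)
    β j = sign j * B zero j * det (minor j B)
    lemma : ∀ s a b t d → s * (a + t * b) * d ≡ s * a * d + t * (s * b * d)
    lemma = solve-∀
    step : ∀ j → sign j * C zero j * det (minor j C) ≡ α j + t * β j
    step j = begin
      sign j * C zero j * det (minor j C)
        ≡⟨ cong (λ c → sign j * c * det (minor j C)) (Cₚ j) ⟩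
      sign j * (A zero j + t * B zero j) * det (minor j C)
        ≡⟨ lemma (sign j) (A zero j) (B zero j) t (det (minor j C)) ⟩
      sign j * A zero j * det (minor j C) + t * (sign j * B zero j * det (minor j C))
        ≡⟨ cong₂ (λ a b → sign j * A zero j * a + t * (sign j * B zero j * b))
             (det-cong λ i k → sym (A≈C (suc i) (λ ()) (punchIn j k)))
             (det-cong λ i k → sym (B≈C (suc i) (λ ()) (punchIn j k))) ⟩
      α j + t * β j ∎
  det-row-linear {suc n} (suc p) t {A} {B} {C} A≈C B≈C Cₚ = begin
    det C ≡⟨ sum-cong-≗ step ⟩
    ∑ℤ (λ j → α j + t * β j) ≡⟨ ∑-linear t α β ⟩
    det A + t * det B ∎
    where
    α β : Vector ℤ (suc n)
    α j = sign j * A zero j * det (minor j A)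
    β j = sign j * B zero j * det (minor j B)
    lemma : ∀ s a b t → s * (a + t * b) ≡ s * a + t * (s * b)
    lemma = solve-∀
    step : ∀ j → sign j * C zero j * det (minor j C) ≡ α j + t * β j
    step j = begin
      sign j * C zero j * det (minor j C)
        ≡⟨ cong (sign j * C zero j *_)
             (det-row-linear p t {minor j A} {minor j B}
               (λ i i≢p k → A≈C (suc i) (i≢p ∘ Fin.suc-injective) (punchIn j k))
               (λ i i≢p k → B≈C (suc i) (i≢p ∘ Fin.suc-injective) (punchIn j k))
               (λ k → Cₚ (punchIn j k))) ⟩
      sign j * C zero j * (det (minor j A) + t * det (minor j B))
        ≡⟨ lemma (sign j * C zero j) (det (minor j A)) (det (minor j B)) t ⟩
      sign j * C zero j * det (minor j A) + t * (sign j * C zero j * det (minor j B))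
        ≡⟨ cong₂ (λ a b → sign j * a * det (minor j A) + t * (sign j * b * det (minor j B)))
             (sym (A≈C zero (λ ()) j)) (sym (B≈C zero (λ ()) j)) ⟩
      α j + t * β j ∎

  -- In the expansion, term `p` sees column `p` only through its entry, while every other term sees
  -- it through that entry's absence: the column survives in the minor, at position `punchOut`.
  det-column-linear : ∀ {n} p t {A B C : Matrix n n} →
    (∀ i j → j ≢ p → A i j ≡ C i j) → (∀ i j → j ≢ p → B i j ≡ C i j) →
    (∀ i → C i p ≡ A i p + t * B i p) →
    det C ≡ det A + t * det B
  det-column-linear {suc n} p t {A} {B} {C} A≈C B≈C Cₚ = begin
    det C ≡⟨ sum-cong-≗ step ⟩
    ∑ℤ (λ j → α j + t * β j) ≡⟨ ∑-linear t α β ⟩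
    det A + t * det B ∎
    where
    α β : Vector ℤ (suc n)
    α j = sign j * A zero j * det (minor j A)
    β j = sign j * B zero j * det (minor j B)
    lemma₁ : ∀ s a b t d → s * (a + t * b) * d ≡ s * a * d + t * (s * b * d)
    lemma₁ = solve-∀
    lemma₂ : ∀ s a b t → s * (a + t * b) ≡ s * a + t * (s * b)
    lemma₂ = solve-∀
    step : ∀ j → sign j * C zero j * det (minor j C) ≡ α j + t * β j
    step j with j Fin.≟ p
    ... | yes refl = begin
      sign j * C zero j * det (minor j C)
        ≡⟨ cong (λ c → sign j * c * det (minor j C)) (Cₚ zero) ⟩
      sign j * (A zero j + t * B zero j) * det (minor j C)
        ≡⟨ lemma₁ (sign j) (A zero j) (B zero j) t (det (minor j C)) ⟩
      sign j * A zero j * det (minor j C) + t * (sign j * B zero j * det (minor j C))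
        ≡⟨ cong₂ (λ a b → sign j * A zero j * a + t * (sign j * B zero j * b))
             (det-cong λ i k → sym (A≈C (suc i) _ (Fin.punchInᵢ≢i j k)))
             (det-cong λ i k → sym (B≈C (suc i) _ (Fin.punchInᵢ≢i j k))) ⟩
      α j + t * β j ∎
    ... | no j≢p = begin
      sign j * C zero j * det (minor j C)
        ≡⟨ cong (sign j * C zero j *_)
             (det-column-linear (punchOut j≢p) t {minor j A} {minor j B}
               (λ i k k≢p′ → A≈C (suc i) _ (off k k≢p′))
               (λ i k k≢p′ → B≈C (suc i) _ (off k k≢p′))
               (λ i → subst (λ q → C (suc i) q ≡ A (suc i) q + t * B (suc i) q)
                        (sym (Fin.punchIn-punchOut j≢p)) (Cₚ (suc i)))) ⟩
      sign j * C zero j * (det (minor j A) + t * det (minor j B))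
        ≡⟨ lemma₂ (sign j * C zero j) (det (minor j A)) (det (minor j B)) t ⟩
      sign j * C zero j * det (minor j A) + t * (sign j * C zero j * det (minor j B))
        ≡⟨ cong₂ (λ a b → sign j * a * det (minor j A) + t * (sign j * b * det (minor j B)))
             (sym (A≈C zero j j≢p)) (sym (B≈C zero j j≢p)) ⟩
      α j + t * β j ∎
      where
      off : ∀ k → k ≢ punchOut j≢p → punchIn j k ≢ p
      off k k≢p′ eq = k≢p′ (Fin.punchIn-injective j k _ (trans eq (sym (Fin.punchIn-punchOut j≢p))))

  ∑-adjacent : ∀ {n} (p : Fin n) {f : Vector ℤ (suc n)} →
    (∀ j → j ≢ inject₁ p → j ≢ suc p → f j ≡ 0ℤ) → f (inject₁ p) + f (suc p) ≡ 0ℤ → ∑ℤ f ≡ 0ℤ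
  ∑-adjacent zero {f} f≡0 fp = begin
    f zero + (f (suc zero) + _) ≡⟨ ℤ.+-assoc (f zero) _ _ ⟨
    (f zero + f (suc zero)) + _ ≡⟨ cong₂ _+_ fp (∑-zero λ j → f≡0 (suc (suc j)) (λ ()) λ ()) ⟩
    0ℤ ∎
  ∑-adjacent (suc p) f≡0 fp = cong₂ _+_ (f≡0 zero (λ ()) λ ())
    (∑-adjacent p (λ j j≢ j≢′ → f≡0 (suc j) (j≢ ∘ Fin.suc-injective) (j≢′ ∘ Fin.suc-injective)) fp)

  -- Two adjacent columns remain adjacent when a third one is deleted, so the induction on minors
  -- never leaves the adjacent case.
  punchIn-adjacent : ∀ {n} (p : Fin (suc n)) j → j ≢ inject₁ p → j ≢ suc p →
    ∃ λ q → punchIn j (inject₁ q) ≡ inject₁ p × punchIn j (suc q) ≡ suc p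
  punchIn-adjacent zero zero j≢ _ = contradiction refl j≢
  punchIn-adjacent zero (suc zero) _ j≢ = contradiction refl j≢
  punchIn-adjacent {suc n} zero (suc (suc j)) _ _ = zero , refl , refl
  punchIn-adjacent (suc p) zero _ _ = p , refl , refl
  punchIn-adjacent {suc n} (suc p) (suc j) j≢ j≢′
    with punchIn-adjacent p j (j≢ ∘ cong suc) (j≢′ ∘ cong suc)
  ... | q , e , e′ = suc q , cong suc e , cong suc e′

  punchIn-inject₁-suc : ∀ {n} (p k : Fin (suc n)) →
    punchIn (inject₁ p) k ≡ punchIn (suc p) k ⊎
    punchIn (inject₁ p) k ≡ suc p × punchIn (suc p) k ≡ inject₁ p
  punchIn-inject₁-suc zero zero = inj₂ (refl , refl)
  punchIn-inject₁-suc zero (suc k) = inj₁ refl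
  punchIn-inject₁-suc (suc p) zero = inj₁ refl
  punchIn-inject₁-suc {suc n} (suc p) (suc k) with punchIn-inject₁-suc p k
  ... | inj₁ e = inj₁ (cong suc e)
  ... | inj₂ (e , e′) = inj₂ (cong suc e , cong suc e′)

  sign-inject₁ : ∀ {n} (p : Fin n) → sign (inject₁ p) ≡ sign p
  sign-inject₁ zero    = refl
  sign-inject₁ (suc p) = cong -_ (sign-inject₁ p)

  -- A minor that keeps both columns vanishes by induction. The two remaining terms have equal
  -- entries and equal minors, and adjacency gives them opposite signs.
  det-adjacent-columns≡0 : ∀ {n} p (A : Matrix (suc n) (suc n)) →
    (∀ i → A i (inject₁ p) ≡ A i (suc p)) → det A ≡ 0ℤ
  det-adjacent-columns≡0 {suc n} p A eq = ∑-adjacent p outside cancel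
    where
    outside : ∀ j → j ≢ inject₁ p → j ≢ suc p → sign j * A zero j * det (minor j A) ≡ 0ℤ
    outside j j≢ j≢′ with punchIn-adjacent p j j≢ j≢′
    ... | q , e , e′ = trans
      (cong (sign j * A zero j *_) (det-adjacent-columns≡0 q (minor j A) λ i →
        subst₂ (λ k k′ → A (suc i) k ≡ A (suc i) k′) (sym e) (sym e′) (eq (suc i))))
      (ℤ.*-zeroʳ (sign j * A zero j))
    minors : minor (inject₁ p) A ≋ minor (suc p) A
    minors i k with punchIn-inject₁-suc p k
    ... | inj₁ e = cong (A (suc i)) e
    ... | inj₂ (e , e′) = trans (cong (A (suc i)) e) (trans (sym (eq (suc i))) (cong (A (suc i)) (sym e′)))
    lemma : ∀ s a d → s * a * d + - s * a * d ≡ 0ℤ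
    lemma = solve-∀
    cancel : sign (inject₁ p) * A zero (inject₁ p) * det (minor (inject₁ p) A)
             + - sign p * A zero (suc p) * det (minor (suc p) A) ≡ 0ℤ
    cancel = trans
      (cong (_+ - sign p * A zero (suc p) * det (minor (suc p) A))
        (cong₂ _*_ (cong₂ _*_ (sign-inject₁ p) (eq zero)) (det-cong minors)))
      (lemma (sign p) (A zero (suc p)) (det (minor (suc p) A)))

  -- Column operations and row exchange

  -- Elementary column operations, acting on each row of a matrix; only adjacent
  -- columns interact, because det-adjacent-columns≡0 covers no others.
  data ColumnOp : ℕ → Set where
    up down : ∀ {n} → ℤ → ColumnOp (suc (suc n))
    there   : ∀ {n} → ColumnOp n → ColumnOp (suc n)

  act : ∀ {n} → ColumnOp n → Vector ℤ n → Vector ℤ n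
  act (up t)    v zero          = v zero + t * v (suc zero)
  act (up t)    v (suc j)       = v (suc j)
  act (down t)  v zero          = v zero
  act (down t)  v (suc zero)    = v (suc zero) + t * v zero
  act (down t)  v (suc (suc j)) = v (suc (suc j))
  act (there o) v zero          = v zero
  act (there o) v (suc j)       = act o (tail v) j

  transpose inverse : ∀ {n} → ColumnOp n → ColumnOp n
  transpose (up t)    = down t
  transpose (down t)  = up t
  transpose (there o) = there (transpose o)
  inverse (up t)    = up (- t)
  inverse (down t)  = down (- t)
  inverse (there o) = there (inverse o)

  act-cong : ∀ {n} (o : ColumnOp n) {v w} → v ≗ w → act o v ≗ act o w
  act-cong (up t)    v≗w zero          = cong₂ (λ a b → a + t * b) (v≗w zero) (v≗w (suc zero))
  act-cong (up t)    v≗w (suc j)       = v≗w (suc j)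
  act-cong (down t)  v≗w zero          = v≗w zero
  act-cong (down t)  v≗w (suc zero)    = cong₂ (λ a b → b + t * a) (v≗w zero) (v≗w (suc zero))
  act-cong (down t)  v≗w (suc (suc j)) = v≗w (suc (suc j))
  act-cong (there o) v≗w zero          = v≗w zero
  act-cong (there o) v≗w (suc j)       = act-cong o (v≗w ∘ suc) j

  act-zero : ∀ {n} (o : ColumnOp n) → act o (const 0ℤ) ≗ const 0ℤ
  act-zero (up t)    zero          = cong (0ℤ +_) (ℤ.*-zeroʳ t)
  act-zero (up t)    (suc j)       = refl
  act-zero (down t)  zero          = refl
  act-zero (down t)  (suc zero)    = cong (0ℤ +_) (ℤ.*-zeroʳ t)
  act-zero (down t)  (suc (suc j)) = refl
  act-zero (there o) zero          = refl
  act-zero (there o) (suc j)       = act-zero o j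

  act-inverse : ∀ {n} (o : ColumnOp n) v → act o (act (inverse o) v) ≗ v
  act-inverse (up t)    v zero = lemma (v zero) t (v (suc zero))
    where
    lemma : ∀ a t b → a + - t * b + t * b ≡ a
    lemma = solve-∀
  act-inverse (up t)    v (suc j) = refl
  act-inverse (down t)  v zero = refl
  act-inverse (down t)  v (suc zero) = lemma (v (suc zero)) t (v zero)
    where
    lemma : ∀ a t b → a + - t * b + t * b ≡ a
    lemma = solve-∀
  act-inverse (down t)  v (suc (suc j)) = refl
  act-inverse (there o) v zero = refl
  act-inverse (there o) v (suc j) = act-inverse o (tail v) j

  infix 7 _∙_
  _∙_ : ∀ {n} → Vector ℤ n → Vector ℤ n → ℤ
  v ∙ c = ∑ℤ λ j → v j * c j

  -- Operating on the columns of a matrix amounts to the transposed change of coefficients. Closure,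
  -- spanning and independence are carried along column operations by this identity.
  act-transpose : ∀ {n} (o : ColumnOp n) v c → act o v ∙ c ≡ v ∙ act (transpose o) c
  act-transpose {suc (suc n)} (up t) v c =
    lemma (v zero) (v (suc zero)) (c zero) (c (suc zero)) t (tail (tail v) ∙ tail (tail c))
    where
    lemma : ∀ a b x y t r → (a + t * b) * x + (b * y + r) ≡ a * x + (b * (y + t * x) + r)
    lemma = solve-∀
  act-transpose {suc (suc n)} (down t) v c =
    lemma (v zero) (v (suc zero)) (c zero) (c (suc zero)) t (tail (tail v) ∙ tail (tail c))
    where
    lemma : ∀ a b x y t r → a * x + ((b + t * a) * y + r) ≡ a * (x + t * y) + (b * y + r)
    lemma = solve-∀
  act-transpose {suc n} (there o) v c = cong (v zero * c zero +_) (act-transpose o (tail v) (tail c))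

  coefficient : ∀ {n} → ColumnOp n → ℤ
  coefficient (up t)    = t
  coefficient (down t)  = t
  coefficient (there o) = coefficient o

  target source : ∀ {n} → ColumnOp n → Fin n
  target (up t)    = zero
  target (down t)  = suc zero
  target (there o) = suc (target o)
  source (up t)    = suc zero
  source (down t)  = zero
  source (there o) = suc (source o)

  act-target : ∀ {n} (o : ColumnOp n) v → act o v (target o) ≡ v (target o) + coefficient o * v (source o)
  act-target (up t)    v = refl
  act-target (down t)  v = refl
  act-target (there o) v = act-target o (tail v)

  act-minimal : ∀ {n} (o : ColumnOp n) v j → j ≢ target o → act o v j ≡ v j
  act-minimal (up t)    v zero          j≢ = contradiction refl j≢
  act-minimal (up t)    v (suc j)       j≢ = refl
  act-minimal (down t)  v zero          j≢ = refl
  act-minimal (down t)  v (suc zero)    j≢ = contradiction refl j≢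
  act-minimal (down t)  v (suc (suc j)) j≢ = refl
  act-minimal (there o) v zero          j≢ = refl
  act-minimal (there o) v (suc j)       j≢ = act-minimal o (tail v) j (j≢ ∘ cong suc)

  target≢source : ∀ {n} (o : ColumnOp n) → target o ≢ source o
  target≢source (there o) eq = target≢source o (Fin.suc-injective eq)

  source-adjacent : ∀ {n} (o : ColumnOp (suc n)) →
    ∃ λ p → (target o ≡ inject₁ p × source o ≡ suc p) ⊎ (target o ≡ suc p × source o ≡ inject₁ p)
  source-adjacent (up t)   = zero , inj₁ (refl , refl)
  source-adjacent (down t) = zero , inj₂ (refl , refl)
  source-adjacent {suc n} (there o) with source-adjacent o
  ... | p , inj₁ (e , e′) = suc p , inj₁ (cong suc e , cong suc e′)
  ... | p , inj₂ (e , e′) = suc p , inj₂ (cong suc e , cong suc e′)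

  -- Linearity in the target column leaves `det A` plus a multiple of `det B`, where `B` has the
  -- source column in both places and these places are adjacent.
  det-act : ∀ {n} (o : ColumnOp n) (A : Matrix n n) → det (act o ∘ A) ≡ det A
  det-act {suc n} o A = begin
    det (act o ∘ A)            ≡⟨ det-column-linear (target o) (coefficient o) {A} {B} {act o ∘ A}
                                    (λ i j j≢ → sym (act-minimal o (A i) j j≢))
                                    (λ i j j≢ → trans (updateAt-minimal j _ (A i) j≢)
                                                  (sym (act-minimal o (A i) j j≢)))
                                    (λ i → trans (act-target o (A i))
                                             (cong (λ b → A i (target o) + coefficient o * b) (sym (Bₜ i)))) ⟩
    det A + coefficient o * det B ≡⟨ cong (λ b → det A + coefficient o * b) B≡0 ⟩
    det A + coefficient o * 0ℤ    ≡⟨ cong (det A +_) (ℤ.*-zeroʳ (coefficient o)) ⟩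
    det A + 0ℤ                    ≡⟨ ℤ.+-identityʳ _ ⟩
    det A ∎
    where
    B : Matrix (suc n) (suc n)
    B i = updateAt (A i) (target o) (const (A i (source o)))
    Bₜ : ∀ i → B i (target o) ≡ A i (source o)
    Bₜ i = updateAt-updates (target o) (A i)
    Bₛ : ∀ i → B i (source o) ≡ A i (source o)
    Bₛ i = updateAt-minimal (source o) (target o) (A i) (target≢source o ∘ sym)
    B≡0 : det B ≡ 0ℤ
    B≡0 with source-adjacent o
    ... | p , inj₁ (e , e′) = det-adjacent-columns≡0 p B λ i →
      subst₂ (λ j k → B i j ≡ B i k) e e′ (trans (Bₜ i) (sym (Bₛ i)))
    ... | p , inj₂ (e , e′) = det-adjacent-columns≡0 p B λ i →
      subst₂ (λ j k → B i j ≡ B i k) e′ e (trans (Bₛ i) (sym (Bₜ i)))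

  acts : ∀ {n} → List (ColumnOp n) → Vector ℤ n → Vector ℤ n
  acts []       v = v
  acts (o ∷ os) v = acts os (act o v)

  acts-cong : ∀ {n} (os : List (ColumnOp n)) {v w} → v ≗ w → acts os v ≗ acts os w
  acts-cong []       v≗w = v≗w
  acts-cong (o ∷ os) v≗w = acts-cong os (act-cong o v≗w)

  acts-++ : ∀ {n} (os ps : List (ColumnOp n)) v → acts (os List.++ ps) v ≡ acts ps (acts os v)
  acts-++ []       ps v = refl
  acts-++ (o ∷ os) ps v = acts-++ os ps (act o v)

  acts-zero : ∀ {n} (os : List (ColumnOp n)) → acts os (const 0ℤ) ≗ const 0ℤ
  acts-zero []       j = refl
  acts-zero (o ∷ os) j = trans (acts-cong os (act-zero o) j) (acts-zero os j)

  acts-there-suc : ∀ {n} (os : List (ColumnOp n)) v j → acts (List.map there os) v (suc j) ≡ acts os (tail v) j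
  acts-there-suc []       v j = refl
  acts-there-suc (o ∷ os) v j = acts-there-suc os (act (there o) v) j

  det-acts : ∀ {n} (os : List (ColumnOp n)) (A : Matrix n n) → det (acts os ∘ A) ≡ det A
  det-acts []       A = refl
  det-acts (o ∷ os) A = trans (det-acts os (act o ∘ A)) (det-act o A)

  -- The Euclidean algorithm on the first two entries: subtract the multiple that
  -- reduces v₀ modulo v₁, then rotate (r , v₁) to (v₁ , - r) by three shears.
  reduce-pair : ∀ {n} (v : Vector ℤ (suc (suc n))) → Acc ℕ._<_ ∣ v (suc zero) ∣ →
    ∃ λ os → acts os v (suc zero) ≡ 0ℤ × ∀ j → acts os v (suc (suc j)) ≡ v (suc (suc j))
  reduce-pair v (acc smaller) with v (suc zero) ℤ.≟ 0ℤ
  ... | yes v₁≡0 = [] , v₁≡0 , λ j → refl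
  ... | no  v₁≢0 = os List.++ proj₁ rest
                 , trans (cong (λ w → w (suc zero)) (acts-++ os (proj₁ rest) v)) (proj₁ (proj₂ rest))
                 , λ j → trans (cong (λ w → w (suc (suc j))) (acts-++ os (proj₁ rest) v)) (proj₂ (proj₂ rest) j)
    where
    instance
      v₁-nonZero : ℤ.NonZero (v (suc zero))
      v₁-nonZero = ℤ.≢-nonZero v₁≢0
    q = v zero ℤ./ v (suc zero)
    os : List (ColumnOp _)
    os = up (- q) ∷ up 1ℤ ∷ down (- 1ℤ) ∷ up 1ℤ ∷ []
    lemma : ∀ r q b → b + - 1ℤ * (r + q * b + - q * b + 1ℤ * b) ≡ - r
    lemma = solve-∀
    reduced : acts os v (suc zero) ≡ - (ℤ.+ (v zero ℤ.% v (suc zero)))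
    reduced = trans
      (cong (λ a → v (suc zero) + - 1ℤ * (a + - q * v (suc zero) + 1ℤ * v (suc zero)))
        (ℤ.a≡a%n+[a/n]*n (v zero) (v (suc zero))))
      (lemma (ℤ.+ (v zero ℤ.% v (suc zero))) q (v (suc zero)))
    rest = reduce-pair (acts os v) (smaller (subst (ℕ._< ∣ v (suc zero) ∣)
      (sym (trans (cong ∣_∣ reduced) (ℤ.∣-i∣≡∣i∣ (ℤ.+ (v zero ℤ.% v (suc zero))))))
      (ℤ.n%d<d (v zero) (v (suc zero)))))

  -- The work goes from right to left: once the tail is reduced, only its first entry may be
  -- non-zero, and one Euclidean algorithm on the first two entries clears it without touching the
  -- zeros behind.
  reduce-row : ∀ {n} (v : Vector ℤ (suc n)) → ∃ λ os → ∀ j → acts os v (suc j) ≡ 0ℤ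
  reduce-row {zero}  v = [] , λ ()
  reduce-row {suc n} v = ps List.++ qs , vanish
    where
    tailOps = reduce-row (tail v)
    ps = List.map there (proj₁ tailOps)
    pairOps = reduce-pair (acts ps v) (<-wellFounded _)
    qs = proj₁ pairOps
    vanish : ∀ j → acts (ps List.++ qs) v (suc j) ≡ 0ℤ
    vanish zero    = trans (cong (λ w → w (suc zero)) (acts-++ ps qs v)) (proj₁ (proj₂ pairOps))
    vanish (suc j) = begin
      acts (ps List.++ qs) v (suc (suc j)) ≡⟨ cong (λ w → w (suc (suc j))) (acts-++ ps qs v) ⟩
      acts qs (acts ps v) (suc (suc j))    ≡⟨ proj₂ (proj₂ pairOps) j ⟩
      acts ps v (suc (suc j))              ≡⟨ acts-there-suc (proj₁ tailOps) v (suc j) ⟩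
      acts (proj₁ tailOps) (tail v) (suc j) ≡⟨ proj₂ tailOps j ⟩
      0ℤ ∎

  -- The recursion through `minor zero` follows the Laplace expansion, so determinants, solutions
  -- and point counts can be peeled off one pivot at a time.
  LowerTriangular : ∀ {n} → Matrix n n → Set
  LowerTriangular {zero}  A = ⊤
  LowerTriangular {suc n} A = (∀ j → A zero (suc j) ≡ 0ℤ) × LowerTriangular (minor zero A)

  LowerTriangular-resp : ∀ {n} {A B : Matrix n n} → A ≋ B → LowerTriangular A → LowerTriangular B
  LowerTriangular-resp {zero}  A≋B _       = tt
  LowerTriangular-resp {suc n} A≋B (z , t) =
    (λ j → trans (sym (A≋B zero (suc j))) (z j)) , LowerTriangular-resp (λ i j → A≋B (suc i) (suc j)) t

  -- After row zero is reduced, the operations for the minor are shifted by `there`. They combine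
  -- only columns in which row zero is already 0, and so preserve its shape.
  triangularize : ∀ {n} (A : Matrix n n) → ∃ λ os → LowerTriangular (acts os ∘ A)
  triangularize {zero}  A = [] , tt
  triangularize {suc n} A = ps List.++ List.map there qs , row₀ , LowerTriangular-resp minors (proj₂ minorOps)
    where
    rowOps = reduce-row (A zero)
    ps = proj₁ rowOps
    minorOps = triangularize (minor zero (acts ps ∘ A))
    qs = proj₁ minorOps
    below : ∀ i j → acts (ps List.++ List.map there qs) (A i) (suc j) ≡ acts qs (tail (acts ps (A i))) j
    below i j = trans (cong (λ w → w (suc j)) (acts-++ ps (List.map there qs) (A i)))
                      (acts-there-suc qs (acts ps (A i)) j)
    row₀ : ∀ j → acts (ps List.++ List.map there qs) (A zero) (suc j) ≡ 0ℤ
    row₀ j = trans (below zero j) (trans (acts-cong qs (proj₂ rowOps) j) (acts-zero qs j))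
    minors : acts qs ∘ minor zero (acts ps ∘ A) ≋ minor zero (acts (ps List.++ List.map there qs) ∘ A)
    minors i j = sym (below (suc i) j)

  det-reduced : ∀ {n} (A : Matrix (suc n) (suc n)) → (∀ j → A zero (suc j) ≡ 0ℤ) →
    det A ≡ A zero zero * det (minor zero A)
  det-reduced A row₀ = trans
    (∑-single zero {λ j → sign j * A zero j * det (minor j A)}
              λ { zero j≢0 → contradiction refl j≢0
                ; (suc j) _ → trans (cong (λ a → sign (suc j) * a * det (minor (suc j) A)) (row₀ j))
                                     (cong (_* det (minor (suc j) A)) (ℤ.*-zeroʳ (sign (suc j)))) })
    (cong (_* det (minor zero A)) (ℤ.*-identityˡ (A zero zero)))

  det-zero-row : ∀ {n} p (A : Matrix n n) → (∀ j → A p j ≡ 0ℤ) → det A ≡ 0ℤ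
  det-zero-row {suc n} zero    A Aₚ = ∑-zero λ j → cong (_* det (minor j A))
    (trans (cong (sign j *_) (Aₚ j)) (ℤ.*-zeroʳ (sign j)))
  det-zero-row {suc n} (suc p) A Aₚ = ∑-zero λ j → trans
    (cong (sign j * A zero j *_) (det-zero-row p (minor j A) (Aₚ ∘ punchIn j)))
    (ℤ.*-zeroʳ (sign j * A zero j))

  -- Column operations that reduce row zero reduce its copy in the same way. Only the minor of the
  -- corner remains, and there the copy has become a zero row.
  det-first-row-repeated : ∀ {n} q (A : Matrix (suc n) (suc n)) → A zero ≗ A (suc q) → det A ≡ 0ℤ
  det-first-row-repeated q A eq with reduce-row (A zero)
  ... | os , reduced = begin
    det A                               ≡⟨ det-acts os A ⟨
    det (acts os ∘ A)                   ≡⟨ det-reduced (acts os ∘ A) reduced ⟩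
    acts os (A zero) zero * det (minor zero (acts os ∘ A))
      ≡⟨ cong (acts os (A zero) zero *_) (det-zero-row q (minor zero (acts os ∘ A)) λ j →
           trans (sym (acts-cong os eq (suc j))) (reduced j)) ⟩
    acts os (A zero) zero * 0ℤ          ≡⟨ ℤ.*-zeroʳ (acts os (A zero) zero) ⟩
    0ℤ ∎

  det-repeated-row : ∀ {n} (p q : Fin n) (A : Matrix n n) → p ≢ q → A p ≗ A q → det A ≡ 0ℤ
  det-repeated-row zero    zero    A p≢q eq = contradiction refl p≢q
  det-repeated-row zero    (suc q) A p≢q eq = det-first-row-repeated q A eq
  det-repeated-row (suc p) zero    A p≢q eq = det-first-row-repeated p A (sym ∘ eq)
  det-repeated-row (suc p) (suc q) A p≢q eq = ∑-zero λ j → trans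
    (cong (sign j * A zero j *_) (det-repeated-row p q (minor j A) (p≢q ∘ cong suc) (eq ∘ punchIn j)))
    (ℤ.*-zeroʳ (sign j * A zero j))

  infixl 8 _[_]≔_
  _[_]≔_ : ∀ {m n} → Matrix m n → Fin m → Vector ℤ n → Matrix m n
  A [ p ]≔ u = updateAt A p (const u)

  det-replace-linear : ∀ {n} (A : Matrix n n) p t {u v w : Vector ℤ n} → (∀ j → w j ≡ u j + t * v j) →
    det (A [ p ]≔ w) ≡ det (A [ p ]≔ u) + t * det (A [ p ]≔ v)
  det-replace-linear A p t {u} {v} {w} eq = det-row-linear p t (agree u) (agree v) λ j →
    trans (at w j) (trans (eq j) (cong₂ (λ a b → a + t * b) (sym (at u j)) (sym (at v j))))
    where
    at : ∀ u j → (A [ p ]≔ u) p j ≡ u j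
    at u j = cong (λ r → r j) (updateAt-updates p A)
    agree : ∀ u i → i ≢ p → (A [ p ]≔ u) i ≗ (A [ p ]≔ w) i
    agree u i i≢p j = cong (λ r → r j) (trans (updateAt-minimal i p A i≢p) (sym (updateAt-minimal i p A i≢p)))

  -- A relation over arbitrary entries, so that it applies both to selections of row indices and to
  -- the rows of a matrix.
  record Swapped {A : Set} {n} (p q : Fin n) (f g : Vector A n) : Set where
    field
      at-p      : g p ≡ f q
      at-q      : g q ≡ f p
      elsewhere : ∀ i → i ≢ p → i ≢ q → g i ≡ f i

  module _ {n : ℕ} (A : Matrix n n) {p q : Fin n} (p≢q : p ≢ q) where

    private
      rows : Vector ℤ n → Vector ℤ n → Matrix n n
      rows u v = A [ p ]≔ u [ q ]≔ v

      rows-p : ∀ u v → rows u v p ≡ u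
      rows-p u v = trans (updateAt-minimal p q (A [ p ]≔ u) p≢q) (updateAt-updates p A)

      rows-q : ∀ u v → rows u v q ≡ v
      rows-q u v = updateAt-updates q (A [ p ]≔ u)

      rows-elsewhere : ∀ u v i → i ≢ p → i ≢ q → rows u v i ≡ A i
      rows-elsewhere u v i i≢p i≢q =
        trans (updateAt-minimal i q (A [ p ]≔ u) i≢q) (updateAt-minimal i p A i≢p)

      rows-unique : ∀ {B : Matrix n n} u v → B p ≗ u → B q ≗ v → (∀ i → i ≢ p → i ≢ q → B i ≗ A i) → B ≋ rows u v
      rows-unique u v Bp Bq B≗A i j with i Fin.≟ p | i Fin.≟ q
      ... | yes refl | _        = trans (Bp j) (cong (λ r → r j) (sym (rows-p u v)))
      ... | no _     | yes refl = trans (Bq j) (cong (λ r → r j) (sym (rows-q u v)))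
      ... | no i≢p   | no i≢q   = trans (B≗A i i≢p i≢q j) (cong (λ r → r j) (sym (rows-elsewhere u v i i≢p i≢q)))

      rows-repeated : ∀ u → det (rows u u) ≡ 0ℤ
      rows-repeated u = det-repeated-row p q (rows u u) p≢q λ j →
        cong (λ r → r j) (trans (rows-p u u) (sym (rows-q u u)))

    -- Polarization of the alternating form (u , v) ↦ det (rows u v).
    det-swap : ∀ {B} → Swapped p q A B → det B ≡ - det A
    det-swap {B} sw = begin
      det B               ≡⟨ det-cong B≋ ⟩
      det (rows v u)      ≡⟨ lemma₂ (det (rows u v)) (det (rows v u)) sum≡0 ⟩
      - det (rows u v)    ≡⟨ cong -_ (det-cong A≋) ⟨
      - det A ∎
      where
      open Swapped sw
      u = A p
      v = A q
      w : Vector ℤ n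
      w j = u j + 1ℤ * v j
      A≋ : A ≋ rows u v
      A≋ = rows-unique u v (λ _ → refl) (λ _ → refl) (λ _ _ _ _ → refl)
      B≋ : B ≋ rows v u
      B≋ = rows-unique v u (λ j → cong (λ r → r j) at-p) (λ j → cong (λ r → r j) at-q)
             (λ i i≢p i≢q j → cong (λ r → r j) (elsewhere i i≢p i≢q))
      first : ∀ x → det (rows w x) ≡ det (rows u x) + 1ℤ * det (rows v x)
      first x = det-row-linear p 1ℤ (agree u) (agree v) λ j →
        trans (cong (λ r → r j) (rows-p w x))
          (cong₂ (λ a b → a j + 1ℤ * b j) (sym (rows-p u x)) (sym (rows-p v x)))
        where
        agree : ∀ y i → i ≢ p → rows y x i ≗ rows w x i
        agree y i i≢p j with i Fin.≟ q
        ... | yes refl = cong (λ r → r j) (trans (rows-q y x) (sym (rows-q w x)))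
        ... | no i≢q   = cong (λ r → r j) (trans (rows-elsewhere y x i i≢p i≢q) (sym (rows-elsewhere w x i i≢p i≢q)))
      second : ∀ x → det (rows x w) ≡ det (rows x u) + 1ℤ * det (rows x v)
      second x = det-replace-linear (A [ p ]≔ x) q 1ℤ (λ j → refl)
      lemma₁ : ∀ a b → a + b ≡ (0ℤ + 1ℤ * a) + 1ℤ * (b + 1ℤ * 0ℤ)
      lemma₁ = solve-∀
      sum≡0 : det (rows u v) + det (rows v u) ≡ 0ℤ
      sum≡0 = begin
        det (rows u v) + det (rows v u)
          ≡⟨ lemma₁ (det (rows u v)) (det (rows v u)) ⟩
        (0ℤ + 1ℤ * det (rows u v)) + 1ℤ * (det (rows v u) + 1ℤ * 0ℤ)
          ≡⟨ cong₂ (λ a b → (a + 1ℤ * det (rows u v)) + 1ℤ * (det (rows v u) + 1ℤ * b))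
               (rows-repeated u) (rows-repeated v) ⟨
        (det (rows u u) + 1ℤ * det (rows u v)) + 1ℤ * (det (rows v u) + 1ℤ * det (rows v v))
          ≡⟨ cong₂ (λ a b → a + 1ℤ * b) (second u) (second v) ⟨
        det (rows u w) + 1ℤ * det (rows v w)
          ≡⟨ first w ⟨
        det (rows w w)
          ≡⟨ rows-repeated w ⟩
        0ℤ ∎
      lemma₂ : ∀ a b → a + b ≡ 0ℤ → b ≡ - a
      lemma₂ a b eq = begin
        b             ≡⟨ lemma₃ a b ⟩
        - a + (a + b) ≡⟨ cong (- a +_) eq ⟩
        - a + 0ℤ      ≡⟨ ℤ.+-identityʳ (- a) ⟩
        - a ∎
        where
        lemma₃ : ∀ a b → b ≡ - a + (a + b)
        lemma₃ = solve-∀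

  -- Maximal minors and Cramer's rule

  -- What sorting needs to know about the absolute value of a minor as a function of the selected
  -- rows; with signs discarded, an exchange changes nothing.
  record IsAlternating {J N} (φ : Vector (Fin N) J → ℕ) : Set where
    field
      resp     : ∀ {f g} → f ≗ g → φ f ≡ φ g
      swapped  : ∀ {f g p q} → p ≢ q → Swapped p q f g → φ g ≡ φ f
      repeated : ∀ {f p q} → p ≢ q → f p ≡ f q → φ f ≡ 0

  lift : ∀ {J N} → Vector (Fin N) J → Vector (Fin (suc N)) (suc J)
  lift f = zero Vector.∷ Vector.map suc f

  lift-cong : ∀ {J N} {f g : Vector (Fin N) J} → f ≗ g → lift f ≗ lift g
  lift-cong f≗g zero    = refl
  lift-cong f≗g (suc i) = cong suc (f≗g i)

  lift-swapped : ∀ {J N} {f g : Vector (Fin N) J} {p q} →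
    Swapped p q f g → Swapped (suc p) (suc q) (lift f) (lift g)
  lift-swapped sw = record
    { at-p      = cong suc (Swapped.at-p sw)
    ; at-q      = cong suc (Swapped.at-q sw)
    ; elsewhere = λ { zero _ _ → refl
                    ; (suc i) i≢p i≢q → cong suc (Swapped.elsewhere sw i (i≢p ∘ cong suc) (i≢q ∘ cong suc)) }
    }

  map-suc-swapped : ∀ {J N} {f g : Vector (Fin N) J} {p q} →
    Swapped p q f g → Swapped {A = Fin (suc N)} p q (Vector.map suc f) (Vector.map suc g)
  map-suc-swapped sw = record
    { at-p      = cong suc (Swapped.at-p sw)
    ; at-q      = cong suc (Swapped.at-q sw)
    ; elsewhere = λ i i≢p i≢q → cong suc (Swapped.elsewhere sw i i≢p i≢q)
    }

  swap₀ : ∀ {A : Set} {n} → Fin n → Vector A (suc n) → Vector A (suc n)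
  swap₀ p f = f (suc p) Vector.∷ updateAt (tail f) p (const (f zero))

  swap₀-swapped : ∀ {A : Set} {n} (p : Fin n) (f : Vector A (suc n)) → Swapped zero (suc p) f (swap₀ p f)
  swap₀-swapped p f = record
    { at-p      = refl
    ; at-q      = updateAt-updates p (tail f)
    ; elsewhere = λ { zero 0≢0 _ → contradiction refl 0≢0
                    ; (suc i) _ i≢p → updateAt-minimal i p (tail f) (i≢p ∘ cong suc) }
    }

  -- Sorting: bring the row zero, if selected, to the front, and recurse.
  alternating-subset : ∀ J N {φ : Vector (Fin N) J → ℕ} → IsAlternating φ →
    ∀ f → φ f ≡ 0 ⊎ ∃ λ I → I ∈ₗ subsets J N × φ f ≡ φ I
  alternating-subset zero N alt f = inj₂ (_ , here refl , IsAlternating.resp alt λ ())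
  alternating-subset (suc J) zero alt f with f zero
  ... | ()
  alternating-subset (suc J) (suc N) {φ} alt f with Fin.any? (λ i → f i Fin.≟ zero)
  ... | no f≢0
    with alternating-subset (suc J) N {φ ∘ Vector.map suc}
           (record { resp     = λ f≗g → resp (cong suc ∘ f≗g)
                   ; swapped  = λ p≢q sw → swapped p≢q (map-suc-swapped sw)
                   ; repeated = λ p≢q eq → repeated p≢q (cong suc eq) })
           (λ i → punchOut (λ eq → f≢0 (i , sym eq)))
    where open IsAlternating alt
  ... | inj₁ φf≡0 = inj₁ (trans (IsAlternating.resp alt λ i → sym (Fin.punchIn-punchOut (λ eq → f≢0 (i , sym eq)))) φf≡0)
  ... | inj₂ (I , I∈ , φf≡φI) = inj₂
    ( Vector.map suc I
    , ∈-++⁺ʳ (List.map lift (subsets J N)) (∈-map⁺ (Vector.map suc) I∈)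
    , trans (IsAlternating.resp alt λ i → sym (Fin.punchIn-punchOut (λ eq → f≢0 (i , sym eq)))) φf≡φI)
  alternating-subset (suc J) (suc N) {φ} alt f | yes (p , fp≡0) = move p fp≡0
    where
    open IsAlternating alt
    front : ∀ g → g zero ≡ zero → φ g ≡ 0 ⊎ ∃ λ I → I ∈ₗ subsets (suc J) (suc N) × φ g ≡ φ I
    front g g₀≡0 with Fin.any? (λ i → g (suc i) Fin.≟ zero)
    ... | yes (q , gq≡0) = inj₁ (repeated {p = zero} {q = suc q} (λ ()) (trans g₀≡0 (sym gq≡0)))
    ... | no g≢0
      with alternating-subset J N {φ ∘ lift}
             (record { resp     = λ f≗g → resp (lift-cong f≗g)
                     ; swapped  = λ p≢q sw → swapped (p≢q ∘ Fin.suc-injective) (lift-swapped sw)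
                     ; repeated = λ {_} {p} {q} p≢q eq →
                         repeated {p = suc p} {q = suc q} (p≢q ∘ Fin.suc-injective) (cong suc eq) })
             (λ i → punchOut (λ eq → g≢0 (i , sym eq)))
         | resp {f = g} {g = lift (λ i → punchOut (λ eq → g≢0 (i , sym eq)))}
             (λ { zero → g₀≡0 ; (suc i) → sym (Fin.punchIn-punchOut (λ eq → g≢0 (i , sym eq))) })
    ... | inj₁ φh≡0           | φg≡φh = inj₁ (trans φg≡φh φh≡0)
    ... | inj₂ (I , I∈ , φh≡φI) | φg≡φh = inj₂ (lift I , ∈-++⁺ˡ (∈-map⁺ lift I∈) , trans φg≡φh φh≡φI)
    move : ∀ p → f p ≡ zero → φ f ≡ 0 ⊎ ∃ λ I → I ∈ₗ subsets (suc J) (suc N) × φ f ≡ φ I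
    move zero    f₀≡0 = front f f₀≡0
    move (suc p) fp≡0 =
      subst (λ x → x ≡ 0 ⊎ ∃ λ I → I ∈ₗ subsets (suc J) (suc N) × x ≡ φ I)
        (swapped {p = zero} {q = suc p} (λ ()) (swap₀-swapped p f)) (front (swap₀ p f) fp≡0)

  ∣minor∣ : ∀ {N J} → Matrix N J → Vector (Fin N) J → ℕ
  ∣minor∣ X f = ∣ det (X ∘ f) ∣

  ∣minor∣-alternating : ∀ {N J} (X : Matrix N J) → IsAlternating (∣minor∣ X)
  ∣minor∣-alternating X = record
    { resp     = λ f≗g → cong ∣_∣ (det-cong λ i j → cong (λ k → X k j) (f≗g i))
    ; swapped  = λ {f} {g} p≢q sw → trans
        (cong ∣_∣ (det-swap (X ∘ f) p≢q (record
          { at-p      = cong X (Swapped.at-p sw)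
          ; at-q      = cong X (Swapped.at-q sw)
          ; elsewhere = λ i i≢p i≢q → cong X (Swapped.elsewhere sw i i≢p i≢q) })))
        (ℤ.∣-i∣≡∣i∣ (det (X ∘ f)))
    ; repeated = λ {f} {p} {q} p≢q eq →
        cong ∣_∣ (det-repeated-row p q (X ∘ f) p≢q λ j → cong (λ k → X k j) eq)
    }

  ∈⇒∣minor∣≤matrixHeight : ∀ {N J} (X : Matrix N J) {I} → I ∈ₗ subsets J N → ∣minor∣ X I ℕ.≤ matrixHeight X
  ∈⇒∣minor∣≤matrixHeight {N} {J} X {I} I∈ =
    foldr-preservesᵒ {P = ∣minor∣ X I ℕ.≤_} (λ x y → [ ℕ.m≤n⇒m≤n⊔o y , ℕ.m≤n⇒m≤o⊔n x ]′) 0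
      (List.map (∣minor∣ X) (subsets J N)) (inj₂ (Any.map ℕ.≤-reflexive (∈-map⁺ (∣minor∣ X) I∈)))

  -- Extends the bound from increasing selections to arbitrary ones: a selection either repeats a
  -- row or can be sorted. Cramer's rule needs this, because replacing one selected row destroys the
  -- order and possibly injectivity.
  ∣minor∣≤matrixHeight : ∀ {N J} (X : Matrix N J) f → ∣minor∣ X f ℕ.≤ matrixHeight X
  ∣minor∣≤matrixHeight {N} {J} X f with alternating-subset J N (∣minor∣-alternating X) f
  ... | inj₁ ≡0 = subst (ℕ._≤ matrixHeight X) (sym ≡0) ℕ.z≤n
  ... | inj₂ (I , I∈ , eq) = subst (ℕ._≤ matrixHeight X) (sym eq) (∈⇒∣minor∣≤matrixHeight X I∈)

  -- Positivity excludes the starting value 0 of the fold, which need not be a minor.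
  matrixHeight-attained : ∀ {N J} (X : Matrix N J) → 0 ℕ.< matrixHeight X → ∃ λ I → ∣minor∣ X I ≡ matrixHeight X
  matrixHeight-attained {N} {J} X 0<H with foldr-selective ℕ.⊔-sel 0 (List.map (∣minor∣ X) (subsets J N))
  ... | inj₁ H≡0 = contradiction (sym H≡0) (ℕ.<⇒≢ 0<H)
  ... | inj₂ H∈ with ∈-map⁻ (∣minor∣ X) H∈
  ...   | I , _ , eq = I , sym eq

  matrixHeight-acts : ∀ {N J} (os : List (ColumnOp J)) (X : Matrix N J) → matrixHeight (acts os ∘ X) ≡ matrixHeight X
  matrixHeight-acts {N} {J} os X = cong (List.foldr ℕ._⊔_ 0)
    (map-cong (λ I → cong ∣_∣ (det-acts os (X ∘ I))) (subsets J N))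

  -- Lattice bases under column operations, and their minors

  Independent : ∀ {N J} → Matrix N J → Set
  Independent X = ∀ c → X · c ≗ const 0ℤ → c ≗ const 0ℤ

  -- A basis whose membership condition speaks of all combinations instead of single columns. In
  -- this form a column operation preserves it by a mere change of coefficients.
  record IsFrame {N J} (Λ : Pred (Vector ℤ N) 0ℓ) (X : Matrix N J) : Set where
    field
      closed      : ∀ c → X · c ∈ Λ
      spanning    : ∀ {x} → x ∈ Λ → ∃ λ c → x ≗ X · c
      independent : Independent X

  ∙-congʳ : ∀ {n} (v : Vector ℤ n) {c d} → c ≗ d → v ∙ c ≡ v ∙ d
  ∙-congʳ v c≗d = sum-cong-≗ λ j → cong (v j *_) (c≗d j)

  inverse-involutive : ∀ {n} (o : ColumnOp n) → inverse (inverse o) ≡ o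
  inverse-involutive (up t)    = cong up (ℤ.neg-involutive t)
  inverse-involutive (down t)  = cong down (ℤ.neg-involutive t)
  inverse-involutive (there o) = cong there (inverse-involutive o)

  act-inverse′ : ∀ {n} (o : ColumnOp n) v → act (inverse o) (act o v) ≗ v
  act-inverse′ o v = subst (λ p → act (inverse o) (act p v) ≗ v) (inverse-involutive o) (act-inverse (inverse o) v)

  independent-act : ∀ {N J} (o : ColumnOp J) {X : Matrix N J} → Independent X → Independent (act o ∘ X)
  independent-act o {X} ind c eq j = begin
    c j                                                ≡⟨ act-inverse′ (transpose o) c j ⟨
    act (inverse (transpose o)) (act (transpose o) c) j
      ≡⟨ act-cong (inverse (transpose o)) (ind _ λ i → trans (sym (act-transpose o (X i) c)) (eq i)) j ⟩
    act (inverse (transpose o)) (const 0ℤ) j           ≡⟨ act-zero (inverse (transpose o)) j ⟩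
    0ℤ ∎

  independent-acts : ∀ {N J} (os : List (ColumnOp J)) {X : Matrix N J} → Independent X → Independent (acts os ∘ X)
  independent-acts []       ind = ind
  independent-acts (o ∷ os) ind = independent-acts os (independent-act o ind)

  module _ {N J : ℕ} {Λ : Pred (Vector ℤ N) 0ℓ} (resp : {x y : Vector ℤ N} → x ≗ y → x ∈ Λ → y ∈ Λ) where

    frame-act : ∀ (o : ColumnOp J) {X} → IsFrame Λ X → IsFrame Λ (act o ∘ X)
    frame-act o {X} frame = record
      { closed = λ c → resp (λ i → sym (act-transpose o (X i) c)) (closed (act (transpose o) c))
      ; spanning = λ x∈ → let c , x≗ = spanning x∈ in
          act (inverse (transpose o)) c , λ i → begin
            _                ≡⟨ x≗ i ⟩
            X i ∙ c          ≡⟨ ∙-congʳ (X i) (act-inverse (transpose o) c) ⟨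
            X i ∙ act (transpose o) (act (inverse (transpose o)) c)
                             ≡⟨ act-transpose o (X i) _ ⟨
            act o (X i) ∙ act (inverse (transpose o)) c ∎
      ; independent = independent-act o independent
      }
      where open IsFrame frame

    frame-acts : ∀ (os : List (ColumnOp J)) {X} → IsFrame Λ X → IsFrame Λ (acts os ∘ X)
    frame-acts []       frame = frame
    frame-acts (o ∷ os) frame = frame-acts os (frame-act o frame)

  module _ {N : ℕ} {Λ : Pred (Vector ℤ N) 0ℓ} (isSubgroup : IsSubgroup Λ) where
    open IsSubgroup isSubgroup

    *-closedⁿ : ∀ n {x} → x ∈ Λ → (λ i → x i * ℤ.+ n) ∈ Λ
    *-closedⁿ zero    {x} x∈ = resp (λ i → sym (ℤ.*-zeroʳ (x i))) 0-closed
    *-closedⁿ (suc n) {x} x∈ = resp (λ i → lemma (x i) (ℤ.+ n)) (+-closed x∈ (*-closedⁿ n x∈))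
      where
      lemma : ∀ a n → a + a * n ≡ a * (1ℤ + n)
      lemma = solve-∀

    *-closed : ∀ t {x} → x ∈ Λ → (λ i → x i * t) ∈ Λ
    *-closed (ℤ.+ n)      x∈ = *-closedⁿ n x∈
    *-closed ℤ.-[1+ n ] {x} x∈ =
      resp (λ i → ℤ.neg-distribʳ-* (x i) (ℤ.+ suc n)) (-‿closed (*-closedⁿ (suc n) x∈))

    ·-closed : ∀ {J} (X : Matrix N J) → (∀ j → (λ i → X i j) ∈ Λ) → ∀ c → X · c ∈ Λ
    ·-closed {zero}  X members c = 0-closed
    ·-closed {suc J} X members c =
      +-closed (*-closed (c zero) (members zero)) (·-closed (tail ∘ X) (members ∘ suc) (tail c))

  lattice-frame : ∀ {N J} (Λ : Lattice N J) → IsFrame (carrier Λ) (Lattice.basis Λ)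
  lattice-frame Λ = record
    { closed      = ·-closed (Lattice.isSubgroup Λ) (Lattice.basis Λ) members
    ; spanning    = spanning
    ; independent = independent
    }
    where open IsBasis (Lattice.isBasis Λ)

  -- Reduce the first row by column operations, which change no minor. If its pivot vanishes, the
  -- row is zero and the rows below are still independent. Otherwise the row is selected, and the
  -- remaining columns are independent below it, as padding a relation with 0 shows.
  nonzero-minor : ∀ {N J} (X : Matrix N J) → Independent X → ∃ λ I → I ∈ₗ subsets J N × det (X ∘ I) ≢ 0ℤ
  nonzero-minor {N}     {zero}  X ind = _ , here refl , λ ()
  nonzero-minor {zero}  {suc J} X ind = contradiction (ind (const 1ℤ) (λ ()) zero) λ ()
  nonzero-minor {suc N} {suc J} X ind with reduce-row (X zero)
  ... | os , row₀ with acts os (X zero) zero ℤ.≟ 0ℤ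
  ...   | yes row₀₀ =
    let I , I∈ , det≢0 = nonzero-minor (acts os ∘ X ∘ suc) λ c eq → independent-acts os {X} ind c
          λ { zero    → ∑-zero {f = λ j → acts os (X zero) j * c j}
                          λ { zero    → cong (_* c zero) row₀₀
                            ; (suc j) → cong (_* c (suc j)) (row₀ j) }
            ; (suc i) → eq i }
    in Vector.map suc I , ∈-++⁺ʳ (List.map lift (subsets J N)) (∈-map⁺ (Vector.map suc) I∈)
       , det≢0 ∘ trans (det-acts os (X ∘ suc ∘ I))
  ...   | no row₀₀≢0 =
    let I , I∈ , det≢0 = nonzero-minor (tail ∘ acts os ∘ X ∘ suc) λ c eq j →
          independent-acts os {X} ind (0ℤ Vector.∷ c)
            (λ { zero    → cong₂ _+_ (ℤ.*-zeroʳ (acts os (X zero) zero))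
                             (∑-zero λ j → cong (λ x → x * c j) (row₀ j))
               ; (suc i) → cong₂ _+_ (ℤ.*-zeroʳ (acts os (X (suc i)) zero)) (eq i) })
            (suc j)
    in lift I , ∈-++⁺ˡ (∈-map⁺ lift I∈)
       , λ eq → [ row₀₀≢0 , det≢0 ]′ (ℤ.i*j≡0⇒i≡0∨j≡0 (acts os (X zero) zero) (begin
           acts os (X zero) zero * det (minor zero (acts os ∘ X ∘ lift I))
             ≡⟨ det-reduced (acts os ∘ X ∘ lift I) row₀ ⟨
           det (acts os ∘ X ∘ lift I) ≡⟨ det-acts os (X ∘ lift I) ⟩
           det (X ∘ lift I)           ≡⟨ eq ⟩
           0ℤ ∎))

  matrixHeight>0 : ∀ {N J} (X : Matrix N J) → Independent X → 0 ℕ.< matrixHeight X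
  matrixHeight>0 X ind = let I , I∈ , det≢0 = nonzero-minor X ind in
    ℕ.<-≤-trans (ℕ.n≢0⇒n>0 (det≢0 ∘ ℤ.∣i∣≡0⇒i≡0)) (∈⇒∣minor∣≤matrixHeight X I∈)

  -- Elimination without division: `E` is a common denominator. The later columns do not involve row
  -- zero, so the minor is solved first. Scaling that solution by the pivot makes room for the
  -- coefficient of row zero, which corrects column zero.
  back-substitution : ∀ {n} (A : Matrix n n) → LowerTriangular A → det A ≢ 0ℤ → (v : Vector ℤ n) →
    ∃₂ λ (E : ℤ) (q : Vector ℤ n) → E ≢ 0ℤ × ∀ j → E * v j ≡ ∑ℤ λ m → q m * A m j
  back-substitution {zero}  A _ det≢0 v = 1ℤ , Vector.[] , (λ ()) , λ ()
  back-substitution {suc n} A (row₀ , lower) det≢0 v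
    with back-substitution (minor zero A) lower
           (λ eq → det≢0 (trans (det-reduced A row₀) (trans (cong (A zero zero *_) eq) (ℤ.*-zeroʳ (A zero zero)))))
           (tail v)
  ... | E , q , E≢0 , combine = a * E , q′
    , (λ eq → [ a≢0 , E≢0 ]′ (ℤ.i*j≡0⇒i≡0∨j≡0 a eq))
    , λ { zero    → combine₀
        ; (suc j) → combine₊ j }
    where
    a = A zero zero
    a≢0 : a ≢ 0ℤ
    a≢0 a≡0 = det≢0 (trans (det-reduced A row₀) (cong (_* det (minor zero A)) a≡0))
    w : Vector ℤ n
    w m = A (suc m) zero
    q′ : Vector ℤ (suc n)
    q′ = (E * v zero + - (q ∙ w)) Vector.∷ λ m → a * q m
    pull : ∀ u → ∑ℤ (λ m → a * q m * u m) ≡ a * (q ∙ u)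
    pull u = trans (sum-cong-≗ λ m → ℤ.*-assoc a (q m) (u m)) (sym (*-distribˡ-sum a (λ m → q m * u m)))
    lemma : ∀ a E v s → a * E * v ≡ (E * v + - s) * a + a * s
    lemma = solve-∀
    combine₀ : a * E * v zero ≡ ∑ℤ λ m → q′ m * A m zero
    combine₀ = trans (lemma a E (v zero) (q ∙ w)) (cong ((E * v zero + - (q ∙ w)) * a +_) (sym (pull w)))
    combine₊ : ∀ j → a * E * v (suc j) ≡ ∑ℤ λ m → q′ m * A m (suc j)
    combine₊ j = begin
      a * E * v (suc j)                       ≡⟨ ℤ.*-assoc a E (v (suc j)) ⟩
      a * (E * v (suc j))                     ≡⟨ cong (a *_) (combine j) ⟩
      a * (q ∙ λ m → A (suc m) (suc j))       ≡⟨ pull (λ m → A (suc m) (suc j)) ⟨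
      ∑ℤ (λ m → a * q m * A (suc m) (suc j))  ≡⟨ ℤ.+-identityˡ _ ⟨
      0ℤ + ∑ℤ (λ m → a * q m * A (suc m) (suc j))
        ≡⟨ cong (_+ ∑ℤ (λ m → a * q m * A (suc m) (suc j)))
             (trans (cong (q′ zero *_) (row₀ j)) (ℤ.*-zeroʳ (q′ zero))) ⟨
      ∑ℤ (λ m → q′ m * A m (suc j)) ∎

  module _ {n : ℕ} (A : Matrix n n) (p : Fin n) where

    det-replace-zero : ∀ {w} → (∀ j → w j ≡ 0ℤ) → det (A [ p ]≔ w) ≡ 0ℤ
    det-replace-zero w≡0 = det-zero-row p _ λ j → trans (cong (λ r → r j) (updateAt-updates p A)) (w≡0 j)

    det-replace-∑ : ∀ {k} (q : Vector ℤ k) (R : Matrix k n) {w} → (∀ j → w j ≡ ∑ℤ λ m → q m * R m j) →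
      det (A [ p ]≔ w) ≡ ∑ℤ λ m → q m * det (A [ p ]≔ R m)
    det-replace-∑ {zero}  q R w≡ = det-replace-zero w≡
    det-replace-∑ {suc k} q R {w} w≡ = begin
      det (A [ p ]≔ w)
        ≡⟨ det-replace-linear A p (q zero) (λ j → trans (w≡ j) (ℤ.+-comm (q zero * R zero j) _)) ⟩
      det (A [ p ]≔ (λ j → ∑ℤ λ m → q (suc m) * R (suc m) j)) + q zero * det (A [ p ]≔ R zero)
        ≡⟨ cong (_+ q zero * det (A [ p ]≔ R zero)) (det-replace-∑ (tail q) (tail R) λ j → refl) ⟩
      ∑ℤ (λ m → q (suc m) * det (A [ p ]≔ R (suc m))) + q zero * det (A [ p ]≔ R zero)
        ≡⟨ ℤ.+-comm _ (q zero * det (A [ p ]≔ R zero)) ⟩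
      (∑ℤ λ m → q m * det (A [ p ]≔ R m)) ∎

    det-replace-other : ∀ m → m ≢ p → det (A [ p ]≔ A m) ≡ 0ℤ
    det-replace-other m m≢p = det-repeated-row m p _ m≢p λ j →
      cong (λ r → r j) (trans (updateAt-minimal m p A m≢p) (sym (updateAt-updates p A)))

    det-replace-self : det (A [ p ]≔ A p) ≡ det A
    det-replace-self = det-cong λ i j → cong (λ r → r j) (same i)
      where
      same : ∀ i → (A [ p ]≔ A p) i ≡ A i
      same i with i Fin.≟ p
      ... | yes refl = updateAt-updates p A
      ... | no i≢p   = updateAt-minimal i p A i≢p

    -- Put `E` times `v` into row `p` and expand in two ways: as a multiple of `v`, and as a
    -- combination of the rows of `A`, of which all but row `p` produce a repeated row.
    cramer : ∀ E {q v} → (∀ j → E * v j ≡ ∑ℤ λ m → q m * A m j) → E * det (A [ p ]≔ v) ≡ q p * det A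
    cramer E {q} {v} combine = begin
      E * det (A [ p ]≔ v)
        ≡⟨ ℤ.+-identityˡ _ ⟨
      0ℤ + E * det (A [ p ]≔ v)
        ≡⟨ cong (_+ E * det (A [ p ]≔ v)) (det-replace-zero λ j → refl) ⟨
      det (A [ p ]≔ const 0ℤ) + E * det (A [ p ]≔ v)
        ≡⟨ det-replace-linear A p E (λ j → sym (ℤ.+-identityˡ (E * v j))) ⟨
      det (A [ p ]≔ (λ j → E * v j))
        ≡⟨ det-replace-∑ q A combine ⟩
      ∑ℤ (λ m → q m * det (A [ p ]≔ A m))
        ≡⟨ ∑-single p (λ m m≢p → trans (cong (q m *_) (det-replace-other m m≢p)) (ℤ.*-zeroʳ (q m))) ⟩
      q p * det (A [ p ]≔ A p)
        ≡⟨ cong (q p *_) det-replace-self ⟩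
      q p * det A ∎

  ∣∑∣≤ : ∀ {n} (f : Vector ℤ n) {B} → (∀ j → ∣ f j ∣ ℕ.≤ B) → ∣ ∑ℤ f ∣ ℕ.≤ n ℕ.* B
  ∣∑∣≤ {zero}  f f≤B = ℕ.z≤n
  ∣∑∣≤ {suc n} f f≤B =
    ℕ.≤-trans (ℤ.∣i+j∣≤∣i∣+∣j∣ (f zero) _) (ℕ.+-mono-≤ (f≤B zero) (∣∑∣≤ (f ∘ suc) (f≤B ∘ suc)))

  -- If a minor of maximal absolute value is used to express a row v as a rational
  -- combination of the rows of X ∘ I, Cramer's rule bounds the coefficients by 1.
  maximal-minor-bound : ∀ {N J} (Y : Matrix N J) I → LowerTriangular (Y ∘ I) → ∣minor∣ Y I ≡ matrixHeight Y →
    0 ℕ.< matrixHeight Y → ∀ c {R} → (∀ j → ∣ (Y · c) (I j) ∣ ℕ.≤ R) → ∀ k → ∣ (Y · c) k ∣ ℕ.≤ J ℕ.* R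
  maximal-minor-bound {N} {J} Y I lower maximal 0<H c {R} bounded k
    with back-substitution (Y ∘ I) lower (λ eq → ℕ.<⇒≢ 0<H (trans (sym (cong ∣_∣ eq)) maximal)) (Y k)
  ... | E , q , E≢0 , combine = ℕ.*-cancelˡ-≤ ∣ E ∣ {{ℕ.≢-nonZero (E≢0 ∘ ℤ.∣i∣≡0⇒i≡0)}} (subst₂ ℕ._≤_
    (trans (sym (cong ∣_∣ expand)) (ℤ.abs-* E _))
    (trans (sym (ℕ.*-assoc J ∣ E ∣ R)) (trans (cong (ℕ._* R) (ℕ.*-comm J ∣ E ∣)) (ℕ.*-assoc ∣ E ∣ J R)))
    (∣∑∣≤ _ λ m → subst (ℕ._≤ ∣ E ∣ ℕ.* R) (sym (ℤ.abs-* (q m) _)) (ℕ.*-mono-≤ (q≤E m) (bounded m))))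
    where
    H-nonZero : ℕ.NonZero (matrixHeight Y)
    H-nonZero = ℕ.>-nonZero 0<H
    expand : E * (Y k ∙ c) ≡ ∑ℤ λ m → q m * (Y (I m) ∙ c)
    expand = begin
      E * (Y k ∙ c)
        ≡⟨ *-distribˡ-sum E (λ j → Y k j * c j) ⟩
      (∑ℤ λ j → E * (Y k j * c j))
        ≡⟨ sum-cong-≗ (λ j → trans (sym (ℤ.*-assoc E (Y k j) (c j))) (cong (_* c j) (combine j))) ⟩
      (∑ℤ λ j → (∑ℤ λ m → q m * Y (I m) j) * c j)
        ≡⟨ sum-cong-≗ (λ j → *-distribʳ-sum (c j) (λ m → q m * Y (I m) j)) ⟩
      (∑ℤ λ j → ∑ℤ λ m → q m * Y (I m) j * c j)
        ≡⟨ ∑-comm (λ j m → q m * Y (I m) j * c j) ⟩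
      (∑ℤ λ m → ∑ℤ λ j → q m * Y (I m) j * c j)
        ≡⟨ sum-cong-≗ (λ m → trans (sum-cong-≗ λ j → ℤ.*-assoc (q m) (Y (I m) j) (c j))
                               (sym (*-distribˡ-sum (q m) λ j → Y (I m) j * c j))) ⟩
      (∑ℤ λ m → q m * (Y (I m) ∙ c)) ∎
    replace≤ : ∀ m → ∣ det ((Y ∘ I) [ m ]≔ Y k) ∣ ℕ.≤ matrixHeight Y
    replace≤ m = subst (ℕ._≤ matrixHeight Y)
      (cong ∣_∣ (det-cong λ i j → cong (λ r → r j) (map-updateAt {f = Y} (λ _ → refl) I m i)))
      (∣minor∣≤matrixHeight Y (updateAt I m (const k)))
    q≤E : ∀ m → ∣ q m ∣ ℕ.≤ ∣ E ∣
    q≤E m = ℕ.*-cancelʳ-≤ ∣ q m ∣ ∣ E ∣ (matrixHeight Y) {{H-nonZero}} (subst₂ ℕ._≤_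
      (begin
        ∣ E ∣ ℕ.* ∣ det ((Y ∘ I) [ m ]≔ Y k) ∣ ≡⟨ ℤ.abs-* E _ ⟨
        ∣ E * det ((Y ∘ I) [ m ]≔ Y k) ∣       ≡⟨ cong ∣_∣ (cramer (Y ∘ I) m E {q} {Y k} combine) ⟩
        ∣ q m * det (Y ∘ I) ∣                  ≡⟨ ℤ.abs-* (q m) _ ⟩
        ∣ q m ∣ ℕ.* ∣minor∣ Y I                ≡⟨ cong (∣ q m ∣ ℕ.*_) maximal ⟩
        ∣ q m ∣ ℕ.* matrixHeight Y ∎)
      refl
      (ℕ.*-monoʳ-≤ ∣ E ∣ (replace≤ m)))

  -- Lattice points in boxes, triangular case

  ∣m-n∣≤n : ∀ m n → m ℕ.≤ n ℕ.+ n → ∣ ℤ.+ m + - ℤ.+ n ∣ ℕ.≤ n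
  ∣m-n∣≤n m n m≤2n rewrite ℤ.m-n≡m⊖n m n with ℕ.≤-total m n
  ... | inj₁ m≤n = ℕ.≤-trans (ℕ.≤-reflexive (ℤ.∣⊖∣-≤ m≤n)) (ℕ.m∸n≤m n m)
  ... | inj₂ n≤m = ℕ.≤-trans (ℕ.≤-reflexive (trans (ℤ.∣m⊖n∣≡∣n⊖m∣ m n) (ℤ.∣⊖∣-≤ n≤m)))
                             (ℕ.m≤n+o⇒m∸n≤o m n m≤2n)

  ∣z∣≤n⇒shift : ∀ z n → ∣ z ∣ ℕ.≤ n → ∃ λ m → m ℕ.≤ n ℕ.+ n × z ≡ ℤ.+ m + - ℤ.+ n
  ∣z∣≤n⇒shift (ℤ.+ k) n k≤n = k ℕ.+ n , ℕ.+-monoˡ-≤ n k≤n , lemma (ℤ.+ k) (ℤ.+ n)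
    where
    lemma : ∀ k n → k ≡ k + n + - n
    lemma = solve-∀
  ∣z∣≤n⇒shift ℤ.-[1+ k ] n k<n = n ℕ.∸ suc k , ℕ.≤-trans (ℕ.m∸n≤m n (suc k)) (ℕ.m≤m+n n n) , (begin
    - ℤ.+ suc k                            ≡⟨ lemma (ℤ.+ suc k) (ℤ.+ n) ⟩
    ℤ.+ n + - ℤ.+ suc k + - ℤ.+ n          ≡⟨ cong (_+ - ℤ.+ n) (trans (ℤ.m-n≡m⊖n n (suc k)) (ℤ.⊖-≥ k<n)) ⟩
    ℤ.+ (n ℕ.∸ suc k) + - ℤ.+ n ∎)
    where
    lemma : ∀ k n → - k ≡ n + - k + - n
    lemma = solve-∀

  -- A sign that is 1 at 0, so multiplication by it is always an involution.
  orientation : ℤ → ℤ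
  orientation (ℤ.+ n)    = 1ℤ
  orientation ℤ.-[1+ n ] = - 1ℤ

  *-orientation : ∀ a → a * orientation a ≡ ℤ.+ ∣ a ∣
  *-orientation (ℤ.+ n)    = ℤ.*-identityʳ (ℤ.+ n)
  *-orientation ℤ.-[1+ n ] = lemma (ℤ.+ suc n)
    where
    lemma : ∀ n → - n * - 1ℤ ≡ n
    lemma = solve-∀

  orientation-involutive : ∀ a c → orientation a * (orientation a * c) ≡ c
  orientation-involutive (ℤ.+ n)    c = trans (ℤ.*-identityˡ (1ℤ * c)) (ℤ.*-identityˡ c)
  orientation-involutive ℤ.-[1+ n ] c = lemma c
    where
    lemma : ∀ c → - 1ℤ * (- 1ℤ * c) ≡ c
    lemma = solve-∀

  -- The floor of (T + b) / d: after this shift the values b + d c start from - T plus the residue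
  -- of T + b. The value at d = 0 is junk, since pivots are non-zero.
  offset : ℕ → ℤ → ℕ → ℤ
  offset T b zero    = 0ℤ
  offset T b (suc d) = (ℤ.+ T + b) ℤ./ℕ suc d

  offset-spec : ∀ T b d → 0 ℕ.< d → ∃ λ ρ → ρ ℕ.< d ×
    ∀ i → b + ℤ.+ d * (i + - offset T b d) ≡ ℤ.+ ρ + ℤ.+ d * i + - ℤ.+ T
  offset-spec T b (suc d) _ = ρ , ℤ.n%ℕd<d (ℤ.+ T + b) (suc d) , λ i → begin
    b + ℤ.+ suc d * (i + - q)
      ≡⟨ lemma₁ (ℤ.+ T) b (ℤ.+ suc d) i q ⟩
    (ℤ.+ T + b) + ℤ.+ suc d * (i + - q) + - ℤ.+ T
      ≡⟨ cong (λ s → s + ℤ.+ suc d * (i + - q) + - ℤ.+ T) (ℤ.a≡a%ℕn+[a/ℕn]*n (ℤ.+ T + b) (suc d)) ⟩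
    (ℤ.+ ρ + q * ℤ.+ suc d) + ℤ.+ suc d * (i + - q) + - ℤ.+ T
      ≡⟨ lemma₂ (ℤ.+ T) (ℤ.+ ρ) (ℤ.+ suc d) i q ⟩
    ℤ.+ ρ + ℤ.+ suc d * i + - ℤ.+ T ∎
    where
    ρ = (ℤ.+ T + b) ℤ.%ℕ suc d
    q = (ℤ.+ T + b) ℤ./ℕ suc d
    lemma₁ : ∀ T b d i q → b + d * (i + - q) ≡ (T + b) + d * (i + - q) + - T
    lemma₁ = solve-∀
    lemma₂ : ∀ T ρ d i q → (ρ + q * d) + d * (i + - q) + - T ≡ ρ + d * i + - T
    lemma₂ = solve-∀

  -- For i = 0, 1, 2, … these are the c, in order, for which b + a c runs through
  -- the values ≥ - T.
  entry : ℕ → ℤ → ℤ → ℤ → ℤ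
  entry T b a i = orientation a * (i + - offset T b ∣ a ∣)

  entry-spec : ∀ T b a → 0 ℕ.< ∣ a ∣ → ∃ λ ρ → ρ ℕ.< ∣ a ∣ ×
    ∀ i → b + a * entry T b a i ≡ ℤ.+ ρ + ℤ.+ ∣ a ∣ * i + - ℤ.+ T
  entry-spec T b a 0<∣a∣ = let ρ , ρ<∣a∣ , spec = offset-spec T b ∣ a ∣ 0<∣a∣ in
    ρ , ρ<∣a∣ , λ i → trans
      (cong (b +_) (trans (sym (ℤ.*-assoc a (orientation a) (i + - offset T b ∣ a ∣)))
                          (cong (_* (i + - offset T b ∣ a ∣)) (*-orientation a))))
      (spec i)

  entry-surjective : ∀ T b a c → c ≡ entry T b a (orientation a * c + offset T b ∣ a ∣)
  entry-surjective T b a c = begin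
    c                                     ≡⟨ orientation-involutive a c ⟨
    orientation a * (orientation a * c)   ≡⟨ cong (orientation a *_) (lemma (orientation a * c) (offset T b ∣ a ∣)) ⟩
    entry T b a (orientation a * c + offset T b ∣ a ∣) ∎
    where
    lemma : ∀ x y → x ≡ x + y + - y
    lemma = solve-∀

  entry-injective : ∀ T b a {i j} → entry T b a i ≡ entry T b a j → i ≡ j
  entry-injective T b a {i} {j} eq = +-cancelʳ (- offset T b ∣ a ∣) i j (begin
    i + - offset T b ∣ a ∣                  ≡⟨ orientation-involutive a _ ⟨
    orientation a * entry T b a i           ≡⟨ cong (orientation a *_) eq ⟩
    orientation a * entry T b a j           ≡⟨ orientation-involutive a _ ⟩
    j + - offset T b ∣ a ∣ ∎)

  entries : ℕ → ℤ → ℤ → ℕ → List ℤ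
  entries T b a k = List.map (entry T b a ∘ ℤ.+_) (List.upTo k)

  length-entries : ∀ T b a k → List.length (entries T b a k) ≡ k
  length-entries T b a k = trans (length-map _ (List.upTo k)) (length-upTo k)

  entries-unique : ∀ T b a k → Unique (entries T b a k)
  entries-unique T b a k = Unique.map⁺ (ℤ.+-injective ∘ entry-injective T b a) (Unique.upTo⁺ k)

  -- The values begin less than one step above - T, so `k` of them, spaced by `∣ a ∣`, end below - T
  -- + `k` `∣ a ∣`.
  ∈-entries⇒≤ : ∀ T b a k → 0 ℕ.< ∣ a ∣ → k ℕ.* ∣ a ∣ ℕ.≤ T ℕ.+ T →
    ∀ {c} → c ∈ₗ entries T b a k → ∣ b + a * c ∣ ℕ.≤ T
  ∈-entries⇒≤ T b a k 0<∣a∣ kd≤2T c∈ with ∈-map⁻ (entry T b a ∘ ℤ.+_) c∈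
  ... | i , i∈ , refl with entry-spec T b a 0<∣a∣
  ...   | ρ , ρ<d , spec = subst (ℕ._≤ T) (sym (cong ∣_∣ value)) (∣m-n∣≤n (ρ ℕ.+ ∣ a ∣ ℕ.* i) T (R.begin
    ρ ℕ.+ ∣ a ∣ ℕ.* i       R.≤⟨ ℕ.+-monoˡ-≤ (∣ a ∣ ℕ.* i) (ℕ.<⇒≤ ρ<d) ⟩
    ∣ a ∣ ℕ.+ ∣ a ∣ ℕ.* i   R.≡⟨ ℕ.*-suc ∣ a ∣ i ⟨
    ∣ a ∣ ℕ.* suc i         R.≤⟨ ℕ.*-monoʳ-≤ ∣ a ∣ (∈-upTo⁻ i∈) ⟩
    ∣ a ∣ ℕ.* k             R.≡⟨ ℕ.*-comm ∣ a ∣ k ⟩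
    k ℕ.* ∣ a ∣             R.≤⟨ kd≤2T ⟩
    T ℕ.+ T R.∎))
    where
    module R = ℕ.≤-Reasoning
    value : b + a * entry T b a (ℤ.+ i) ≡ ℤ.+ (ρ ℕ.+ ∣ a ∣ ℕ.* i) + - ℤ.+ T
    value = trans (spec (ℤ.+ i)) (cong (λ x → ℤ.+ ρ + x + - ℤ.+ T) (sym (ℤ.pos-* ∣ a ∣ i)))

  -- A remainder smaller than `d` cannot compensate even one negative step, so no value in the box
  -- precedes the first entry.
  nonnegative-quotient : ∀ {ρ d m} i → ρ ℕ.< d → ℤ.+ ρ + ℤ.+ d * i ≡ ℤ.+ m → ∃ λ n → i ≡ ℤ.+ n × d ℕ.* n ℕ.≤ m
  nonnegative-quotient {ρ} {d} {m} (ℤ.+ n) ρ<d eq = n , refl , subst (d ℕ.* n ℕ.≤_)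
    (ℤ.+-injective (trans (cong (ℤ.+ ρ +_) (ℤ.pos-* d n)) eq)) (ℕ.m≤n+m (d ℕ.* n) ρ)
  nonnegative-quotient {ρ} {d} {m} ℤ.-[1+ n ] ρ<d eq = contradiction ρ<d (ℕ.≤⇒≯ (subst (d ℕ.≤_) (sym ρ≡) d≤))
    where
    lemma : ∀ ρ d n → ρ ≡ (ρ + d * - n) + d * n
    lemma = solve-∀
    ρ≡ : ρ ≡ m ℕ.+ d ℕ.* suc n
    ρ≡ = ℤ.+-injective (trans (lemma (ℤ.+ ρ) (ℤ.+ d) (ℤ.+ suc n)) (cong₂ _+_ eq (sym (ℤ.pos-* d (suc n)))))
    d≤ : d ℕ.≤ m ℕ.+ d ℕ.* suc n
    d≤ = ℕ.≤-trans (ℕ.m≤m*n d (suc n)) (ℕ.m≤n+m (d ℕ.* suc n) m)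

  ≤⇒∈-entries : ∀ T b a k → 0 ℕ.< ∣ a ∣ → T ℕ.+ T ℕ.< k ℕ.* ∣ a ∣ →
    ∀ c → ∣ b + a * c ∣ ℕ.≤ T → c ∈ₗ entries T b a k
  ≤⇒∈-entries T b a k 0<∣a∣ 2T<kd c bounded
    with entry-spec T b a 0<∣a∣ | ∣z∣≤n⇒shift _ T bounded
  ... | ρ , ρ<d , spec | m , m≤2T , shifted
    with nonnegative-quotient (orientation a * c + offset T b ∣ a ∣) ρ<d (+-cancelʳ (- ℤ.+ T) _ _
           (trans (sym (spec (orientation a * c + offset T b ∣ a ∣)))
             (trans (cong (λ x → b + a * x) (sym (entry-surjective T b a c))) shifted)))
  ... | n , i≡n , dn≤m = subst (_∈ₗ entries T b a k)
    (sym (trans (entry-surjective T b a c) (cong (entry T b a) i≡n)))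
    (∈-map⁺ (entry T b a ∘ ℤ.+_) (∈-upTo⁺ (ℕ.*-cancelʳ-< ∣ a ∣ n k (ℕ.≤-<-trans
      (subst (ℕ._≤ T ℕ.+ T) (ℕ.*-comm ∣ a ∣ n) (ℕ.≤-trans dn≤m m≤2T)) 2T<kd))))

  pivot>0 : ∀ {n} (A : Matrix (suc n) (suc n)) → LowerTriangular A → det A ≢ 0ℤ → 0 ℕ.< ∣ A zero zero ∣
  pivot>0 A (row₀ , _) det≢0 = ℕ.n≢0⇒n>0 λ eq →
    det≢0 (trans (det-reduced A row₀) (cong (_* det (minor zero A)) (ℤ.∣i∣≡0⇒i≡0 {A zero zero} eq)))

  det-minor≢0 : ∀ {n} (A : Matrix (suc n) (suc n)) → LowerTriangular A → det A ≢ 0ℤ → det (minor zero A) ≢ 0ℤ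
  det-minor≢0 A (row₀ , _) det≢0 eq =
    det≢0 (trans (det-reduced A row₀) (trans (cong (A zero zero *_) eq) (ℤ.*-zeroʳ (A zero zero))))

  ∣det∣-triangular : ∀ {n} (A : Matrix (suc n) (suc n)) → LowerTriangular A →
    ∣ det A ∣ ≡ ∣ A zero zero ∣ ℕ.* ∣ det (minor zero A) ∣
  ∣det∣-triangular A (row₀ , _) = trans (cong ∣_∣ (det-reduced A row₀)) (ℤ.abs-* (A zero zero) (det (minor zero A)))

  -- One enumeration serves both counts. With ⌊2T / a⌋ candidates per coefficient it stays inside
  -- the box; with one candidate more it exhausts the box.
  module Points (κ : ℕ → ℕ) (T : ℕ) where

    shift : ∀ {n} → Matrix (suc n) (suc n) → Vector ℤ (suc n) → ℤ → Vector ℤ n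
    shift A b c j = b (suc j) + A (suc j) zero * c

    -- For A lower triangular: κ ∣ a ∣ many candidates for each coefficient in
    -- turn, a being the diagonal entry, starting where b + A c first reaches - T.
    points : ∀ {n} → Matrix n n → Vector ℤ n → List (Vec ℤ n)
    points {zero}  A b = [] ∷ []
    points {suc n} A b = List.concatMap (λ c → List.map (c ∷_) (points (minor zero A) (shift A b c)))
      (entries T (b zero) (A zero zero) (κ ∣ A zero zero ∣))

    weight : ∀ {n} → Matrix n n → ℕ
    weight {zero}  A = 1
    weight {suc n} A = κ ∣ A zero zero ∣ ℕ.* weight (minor zero A)

    length-concatMap : ∀ {B C : Set} {f : B → List C} {m} → (∀ x → List.length (f x) ≡ m) →
      ∀ xs → List.length (List.concatMap f xs) ≡ List.length xs ℕ.* m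
    length-concatMap         len []       = refl
    length-concatMap {f = f} len (x ∷ xs) = trans (length-++ (f x)) (cong₂ ℕ._+_ (len x) (length-concatMap len xs))

    -- `κ` sees only the pivot, and a chosen coefficient changes `b` but not the minor, so all
    -- branches have equally many points.
    length-points : ∀ {n} (A : Matrix n n) b → List.length (points A b) ≡ weight A
    length-points {zero}  A b = refl
    length-points {suc n} A b = trans
      (length-concatMap (λ c → trans (length-map (c ∷_) (points (minor zero A) (shift A b c)))
                                 (length-points (minor zero A) (shift A b c)))
        (entries T (b zero) (A zero zero) (κ ∣ A zero zero ∣)))
      (cong (ℕ._* weight (minor zero A)) (length-entries T (b zero) (A zero zero) (κ ∣ A zero zero ∣)))

    points-unique : ∀ {n} (A : Matrix n n) b → Unique (points A b)
    points-unique {zero}  A b = All.[] ∷ []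
    points-unique {suc n} A b = Unique.concat⁺
      (All.map⁺ (All.universal (λ c → Unique.map⁺ Vec.∷-injectiveʳ (points-unique (minor zero A) (shift A b c)))
                  (entries T (b zero) (A zero zero) (κ ∣ A zero zero ∣))))
      (AllPairs.map⁺ (AllPairs.map disjoint (entries-unique T (b zero) (A zero zero) (κ ∣ A zero zero ∣))))
      where
      disjoint : ∀ {c d} → c ≢ d → ∀ {v} →
        ¬ (v ∈ₗ List.map (c ∷_) (points (minor zero A) (shift A b c)) ×
           v ∈ₗ List.map (d ∷_) (points (minor zero A) (shift A b d)))
      disjoint {c} {d} c≢d (v∈ , v∈′) with ∈-map⁻ (c ∷_) v∈ | ∈-map⁻ (d ∷_) v∈′
      ... | _ , _ , refl | _ , _ , eq = c≢d (Vec.∷-injectiveˡ eq)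

    first-value : ∀ {n} (A : Matrix (suc n) (suc n)) (b : Vector ℤ (suc n)) c (cs : Vec ℤ n) → (∀ j → A zero (suc j) ≡ 0ℤ) →
      b zero + A zero ∙ Vec.lookup (c ∷ cs) ≡ b zero + A zero zero * c
    first-value A b c cs row₀ = cong (b zero +_) (trans
      (cong (A zero zero * c +_) (∑-zero λ j → cong (_* Vec.lookup cs j) (row₀ j)))
      (ℤ.+-identityʳ (A zero zero * c)))

    later-value : ∀ {n} (A : Matrix (suc n) (suc n)) b c (cs : Vec ℤ n) j →
      shift A b c j + minor zero A j ∙ Vec.lookup cs ≡ b (suc j) + A (suc j) ∙ Vec.lookup (c ∷ cs)
    later-value A b c cs j = ℤ.+-assoc (b (suc j)) (A (suc j) zero * c) (minor zero A j ∙ Vec.lookup cs)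

    ∈-points⇒≤ : (∀ d → κ d ℕ.* d ℕ.≤ T ℕ.+ T) → ∀ {n} (A : Matrix n n) b → LowerTriangular A → det A ≢ 0ℤ →
      ∀ {c} → c ∈ₗ points A b → ∀ j → ∣ b j + A j ∙ Vec.lookup c ∣ ℕ.≤ T
    ∈-points⇒≤ κ≤ {suc n} A b lower det≢0 v∈ j
      with find (∈-concatMap⁻ (λ c → List.map (c ∷_) (points (minor zero A) (shift A b c)))
                  {xs = entries T (b zero) (A zero zero) (κ ∣ A zero zero ∣)} v∈)
    ... | c , c∈ , v∈′ with ∈-map⁻ (c ∷_) v∈′
    ∈-points⇒≤ κ≤ {suc n} A b lower det≢0 v∈ zero | c , c∈ , v∈′ | cs , cs∈ , refl =
      subst (ℕ._≤ T) (sym (cong ∣_∣ (first-value A b c cs (proj₁ lower))))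
        (∈-entries⇒≤ T (b zero) (A zero zero) (κ ∣ A zero zero ∣) (pivot>0 A lower det≢0) (κ≤ ∣ A zero zero ∣) c∈)
    ∈-points⇒≤ κ≤ {suc n} A b lower det≢0 v∈ (suc j) | c , c∈ , v∈′ | cs , cs∈ , refl =
      subst (ℕ._≤ T) (cong ∣_∣ (later-value A b c cs j))
        (∈-points⇒≤ κ≤ (minor zero A) (shift A b c) (proj₂ lower) (det-minor≢0 A lower det≢0) cs∈ j)

    ≤⇒∈-points : (∀ d → 0 ℕ.< d → T ℕ.+ T ℕ.< κ d ℕ.* d) →
      ∀ {n} (A : Matrix n n) b → LowerTriangular A → det A ≢ 0ℤ →
      ∀ c → (∀ j → ∣ b j + A j ∙ Vec.lookup c ∣ ℕ.≤ T) → c ∈ₗ points A b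
    ≤⇒∈-points κ> {zero}  A b lower det≢0 []       bounded = here refl
    ≤⇒∈-points κ> {suc n} A b lower det≢0 (c ∷ cs) bounded =
      ∈-concatMap⁺ (λ c → List.map (c ∷_) (points (minor zero A) (shift A b c))) (Any.map
        (λ { refl → ∈-map⁺ (c ∷_) (≤⇒∈-points κ> (minor zero A) (shift A b c) (proj₂ lower) (det-minor≢0 A lower det≢0) cs
               λ j → subst (ℕ._≤ T) (cong ∣_∣ (sym (later-value A b c cs j))) (bounded (suc j))) })
        (≤⇒∈-entries T (b zero) (A zero zero) (κ ∣ A zero zero ∣) (pivot>0 A lower det≢0)
          (κ> ∣ A zero zero ∣ (pivot>0 A lower det≢0)) c
          (subst (ℕ._≤ T) (cong ∣_∣ (first-value A b c cs (proj₁ lower))) (bounded zero))))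

  -- Exact and upper counts of the enumerated points

  quotient : ℕ → ℕ → ℕ
  quotient m zero    = 0
  quotient m (suc d) = m ℕ./ suc d

  quotient-*-≤ : ∀ m d → quotient m d ℕ.* d ℕ.≤ m
  quotient-*-≤ m zero    = ℕ.z≤n
  quotient-*-≤ m (suc d) = ℕ.m/n*n≤m m (suc d)

  quotient-*-∣ : ∀ {m d} → 0 ℕ.< d → d ℕ.∣ m → quotient m d ℕ.* d ≡ m
  quotient-*-∣ {d = suc d} _ d∣m = ℕ.m/n*n≡m d∣m

  <-suc-quotient-* : ∀ m d → 0 ℕ.< d → m ℕ.< suc (quotient m d) ℕ.* d
  <-suc-quotient-* m (suc d) _ = subst (ℕ._< suc (m ℕ./ suc d) ℕ.* suc d) (sym (ℕ.m≡m%n+[m/n]*n m (suc d)))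
    (ℕ.+-monoˡ-< (m ℕ./ suc d ℕ.* suc d) (ℕ.m%n<n m (suc d)))

  -- Each pivot divides the determinant and hence `m`, so every quotient is exact and the pivots
  -- multiply up to the determinant.
  weight-divisible : ∀ T m {n} (A : Matrix n n) → LowerTriangular A → det A ≢ 0ℤ → ∣ det A ∣ ℕ.∣ m →
    Points.weight (quotient m) T A ℕ.* ∣ det A ∣ ≡ m ℕ.^ n
  weight-divisible T m {zero}  A lower det≢0 _   = refl
  weight-divisible T m {suc n} A lower det≢0 D∣m = begin
    quotient m a ℕ.* W ℕ.* ∣ det A ∣   ≡⟨ cong (quotient m a ℕ.* W ℕ.*_) (∣det∣-triangular A lower) ⟩
    quotient m a ℕ.* W ℕ.* (a ℕ.* D)   ≡⟨ lemma (quotient m a) W a D ⟩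
    quotient m a ℕ.* a ℕ.* (W ℕ.* D)
      ≡⟨ cong₂ ℕ._*_
           (quotient-*-∣ (pivot>0 A lower det≢0) (ℕ.∣-trans (ℕ.m∣m*n D) aD∣m))
           (weight-divisible T m (minor zero A) (proj₂ lower) (det-minor≢0 A lower det≢0) (ℕ.∣-trans (ℕ.n∣m*n a) aD∣m)) ⟩
    m ℕ.* m ℕ.^ n ∎
    where
    open Points (quotient m) T
    a = ∣ A zero zero ∣
    D = ∣ det (minor zero A) ∣
    W = weight (minor zero A)
    aD∣m : a ℕ.* D ℕ.∣ m
    aD∣m = subst (ℕ._∣ m) (∣det∣-triangular A lower) D∣m
    lemma : ∀ q W a D → q ℕ.* W ℕ.* (a ℕ.* D) ≡ q ℕ.* a ℕ.* (W ℕ.* D)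
    lemma = ℕRing.solve-∀

  -- The right side exceeds the left by m (a - 1) (b - 1). This merges two pivots into one pivot `a`
  -- `b` and a pivot 1.
  [m+a][m+b]≤[m+ab][1+m] : ∀ m a b → 0 ℕ.< a → 0 ℕ.< b →
    (m ℕ.+ a) ℕ.* (m ℕ.+ b) ℕ.≤ (m ℕ.+ a ℕ.* b) ℕ.* suc m
  [m+a][m+b]≤[m+ab][1+m] m (suc a) (suc b) _ _ = subst ((m ℕ.+ suc a) ℕ.* (m ℕ.+ suc b) ℕ.≤_)
    (lemma m a b) (ℕ.m≤m+n _ (m ℕ.* a ℕ.* b))
    where
    lemma : ∀ m a b → (m ℕ.+ (1 ℕ.+ a)) ℕ.* (m ℕ.+ (1 ℕ.+ b)) ℕ.+ m ℕ.* a ℕ.* b ≡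
                      (m ℕ.+ (1 ℕ.+ a) ℕ.* (1 ℕ.+ b)) ℕ.* (1 ℕ.+ m)
    lemma = ℕRing.solve-∀

  -- Each factor is at most (m + a) / a, and the pivots are merged one by one into the determinant.
  -- The spare factor `suc m` on the left replaces the exponent n - 1 on the right, which would fail
  -- at n = 0.
  weight-upper : ∀ T m {n} (A : Matrix n n) → LowerTriangular A → det A ≢ 0ℤ →
    Points.weight (suc ∘ quotient m) T A ℕ.* ∣ det A ∣ ℕ.* suc m ℕ.≤ (m ℕ.+ ∣ det A ∣) ℕ.* suc m ℕ.^ n
  weight-upper T m {zero}  A lower det≢0 = ℕ.≤-reflexive (lemma m)
    where
    lemma : ∀ m → 1 ℕ.* 1 ℕ.* (1 ℕ.+ m) ≡ (m ℕ.+ 1) ℕ.* 1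
    lemma = ℕRing.solve-∀
  weight-upper T m {suc n} A lower det≢0 = R.begin
    suc q ℕ.* W ℕ.* ∣ det A ∣ ℕ.* suc m        R.≡⟨ cong (λ d → suc q ℕ.* W ℕ.* d ℕ.* suc m) (∣det∣-triangular A lower) ⟩
    suc q ℕ.* W ℕ.* (a ℕ.* D) ℕ.* suc m        R.≡⟨ lemma₁ (suc q) W a D (suc m) ⟩
    (suc q ℕ.* a) ℕ.* (W ℕ.* D ℕ.* suc m)
      R.≤⟨ ℕ.*-mono-≤ (subst (suc q ℕ.* a ℕ.≤_) (ℕ.+-comm a m) (ℕ.+-monoʳ-≤ a (quotient-*-≤ m a)))
           (weight-upper T m (minor zero A) (proj₂ lower) (det-minor≢0 A lower det≢0)) ⟩
    (m ℕ.+ a) ℕ.* ((m ℕ.+ D) ℕ.* suc m ℕ.^ n)  R.≡⟨ ℕ.*-assoc (m ℕ.+ a) (m ℕ.+ D) _ ⟨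
    (m ℕ.+ a) ℕ.* (m ℕ.+ D) ℕ.* suc m ℕ.^ n
      R.≤⟨ ℕ.*-monoˡ-≤ (suc m ℕ.^ n) ([m+a][m+b]≤[m+ab][1+m] m a D (pivot>0 A lower det≢0)
           (ℕ.n≢0⇒n>0 (det-minor≢0 A lower det≢0 ∘ ℤ.∣i∣≡0⇒i≡0))) ⟩
    (m ℕ.+ a ℕ.* D) ℕ.* suc m ℕ.* suc m ℕ.^ n  R.≡⟨ ℕ.*-assoc (m ℕ.+ a ℕ.* D) (suc m) _ ⟩
    (m ℕ.+ a ℕ.* D) ℕ.* suc m ℕ.^ suc n
      R.≡⟨ cong (λ d → (m ℕ.+ d) ℕ.* suc m ℕ.^ suc n) (∣det∣-triangular A lower) ⟨
    (m ℕ.+ ∣ det A ∣) ℕ.* suc m ℕ.^ suc n R.∎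
    where
    module R = ℕ.≤-Reasoning
    open Points (suc ∘ quotient m) T
    a = ∣ A zero zero ∣
    D = ∣ det (minor zero A) ∣
    W = weight (minor zero A)
    q = quotient m a
    lemma₁ : ∀ q W a D s → q ℕ.* W ℕ.* (a ℕ.* D) ℕ.* s ≡ (q ℕ.* a) ℕ.* (W ℕ.* D ℕ.* s)
    lemma₁ = ℕRing.solve-∀

  -- Lattice points in boxes

  record TriangularFrame {N J} (Λ : Lattice N J) : Set where
    field
      frame      : Matrix N J
      rows       : Vector (Fin N) J
      isFrame    : IsFrame (carrier Λ) frame
      triangular : LowerTriangular (frame ∘ rows)
      height≡    : matrixHeight frame ≡ latticeHeight Λ
      maximal    : ∣minor∣ frame rows ≡ latticeHeight Λ
      height>0   : 0 ℕ.< latticeHeight Λ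

    open IsFrame isFrame public

    det≢0 : det (frame ∘ rows) ≢ 0ℤ
    det≢0 eq = ℕ.<⇒≢ height>0 (trans (sym (cong ∣_∣ eq)) maximal)

  triangular-frame : ∀ {N J} (Λ : Lattice N J) → TriangularFrame Λ
  triangular-frame Λ = record
    { frame      = acts os ∘ X
    ; rows       = I
    ; isFrame    = frame-acts (IsSubgroup.resp (Lattice.isSubgroup Λ)) os (lattice-frame Λ)
    ; triangular = proj₂ triangularized
    ; height≡    = matrixHeight-acts os X
    ; maximal    = trans (cong ∣_∣ (det-acts os (X ∘ I))) (proj₂ attained)
    ; height>0   = H>0
    }
    where
    X = Lattice.basis Λ
    H>0 = matrixHeight>0 X (IsFrame.independent (lattice-frame Λ))
    attained = matrixHeight-attained X H>0
    I = proj₁ attained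
    triangularized = triangularize (X ∘ I)
    os = proj₁ triangularized

  -- Bounding only the coordinates in the rows of a maximal minor already confines the point to the
  -- enumeration, and the determinant there is the height. Points are listed as `Vec`, where
  -- equality is decidable, for the later search for a fresh point.
  lattice-cover : ∀ {N J} (Λ : Lattice N J) T → ∃ λ (xs : List (Vec ℤ N)) →
    (∀ {x} → x ∈ carrier Λ → (∀ k → ∣ x k ∣ ℕ.≤ T) → Vec.tabulate x ∈ₗ xs) ×
    List.length xs ℕ.* latticeHeight Λ ℕ.* suc (T ℕ.+ T) ℕ.≤ (T ℕ.+ T ℕ.+ latticeHeight Λ) ℕ.* suc (T ℕ.+ T) ℕ.^ J
  lattice-cover {N} {J} Λ T = List.map embed (points A (const 0ℤ)) , covers , count
    where
    open TriangularFrame (triangular-frame Λ)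
    open Points (suc ∘ quotient (T ℕ.+ T)) T
    A = frame ∘ rows
    embed : Vec ℤ J → Vec ℤ N
    embed c = Vec.tabulate (frame · Vec.lookup c)
    covers : ∀ {x} → x ∈ carrier Λ → (∀ k → ∣ x k ∣ ℕ.≤ T) → Vec.tabulate x ∈ₗ List.map embed (points A (const 0ℤ))
    covers {x} x∈ bounded with spanning x∈
    ... | c , x≗ = subst (_∈ₗ List.map embed (points A (const 0ℤ))) (sym (Vec.tabulate-cong x≗′))
      (∈-map⁺ embed (≤⇒∈-points (<-suc-quotient-* (T ℕ.+ T)) A (const 0ℤ) triangular det≢0 (Vec.tabulate c) λ j →
        subst (λ z → ∣ z ∣ ℕ.≤ T) (trans (x≗′ (rows j)) (sym (ℤ.+-identityˡ _))) (bounded (rows j))))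
      where
      x≗′ : x ≗ frame · Vec.lookup (Vec.tabulate c)
      x≗′ k = trans (x≗ k) (∙-congʳ (frame k) (sym ∘ Vec.lookup∘tabulate c))
    count : List.length (List.map embed (points A (const 0ℤ))) ℕ.* latticeHeight Λ ℕ.* suc (T ℕ.+ T)
            ℕ.≤ (T ℕ.+ T ℕ.+ latticeHeight Λ) ℕ.* suc (T ℕ.+ T) ℕ.^ J
    count = subst₂ (λ w h → w ℕ.* h ℕ.* suc (T ℕ.+ T) ℕ.≤ (T ℕ.+ T ℕ.+ h) ℕ.* suc (T ℕ.+ T) ℕ.^ J)
      (sym (trans (length-map embed (points A (const 0ℤ))) (length-points A (const 0ℤ)))) maximal
      (weight-upper T (T ℕ.+ T) A triangular det≢0)

  frame-injective : ∀ {N J} {X : Matrix N J} → Independent X → ∀ {c d} → X · c ≗ X · d → c ≗ d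
  frame-injective {X = X} ind {c} {d} eq j = x-y≡0⇒x≡y (c j) (d j) (ind (λ j → c j + - d j) difference j)
    where
    lemma₁ : ∀ x c d → x * (c + - d) ≡ x * c + - 1ℤ * (x * d)
    lemma₁ = solve-∀
    lemma₂ : ∀ x → x + - 1ℤ * x ≡ 0ℤ
    lemma₂ = solve-∀
    difference : X · (λ j → c j + - d j) ≗ const 0ℤ
    difference i = begin
      ∑ℤ (λ j → X i j * (c j + - d j))
        ≡⟨ sum-cong-≗ (λ j → lemma₁ (X i j) (c j) (d j)) ⟩
      ∑ℤ (λ j → X i j * c j + - 1ℤ * (X i j * d j))
        ≡⟨ ∑-linear (- 1ℤ) (λ j → X i j * c j) (λ j → X i j * d j) ⟩
      X i ∙ c + - 1ℤ * (X i ∙ d)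
        ≡⟨ cong (λ s → s + - 1ℤ * (X i ∙ d)) (eq i) ⟩
      X i ∙ d + - 1ℤ * (X i ∙ d)
        ≡⟨ lemma₂ (X i ∙ d) ⟩
      0ℤ ∎

  lookup-injective : ∀ {A : Set} {n} (xs ys : Vec A n) → Vec.lookup xs ≗ Vec.lookup ys → xs ≡ ys
  lookup-injective xs ys eq =
    trans (sym (Vec.tabulate∘lookup xs)) (trans (Vec.tabulate-cong eq) (Vec.tabulate∘lookup ys))

  -- As `R` is a multiple of the height, the count is exact. `maximal-minor-bound` passes from `R`
  -- in the selected rows to `J` times `R` in all rows.
  lattice-points : ∀ {N J} (Λ : Lattice N J) k → let R = k ℕ.* latticeHeight Λ in ∃ λ (xs : List (Vec ℤ N)) →
    Unique xs ×
    (∀ {x} → x ∈ₗ xs → Vec.lookup x ∈ carrier Λ × ∀ i → ∣ Vec.lookup x i ∣ ℕ.≤ J ℕ.* R) ×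
    List.length xs ℕ.* latticeHeight Λ ≡ (R ℕ.+ R) ℕ.^ J
  lattice-points {N} {J} Λ k =
    List.map embed ps , Unique.map⁺ embed-injective (points-unique A (const 0ℤ)) , bounded , count
    where
    open TriangularFrame (triangular-frame Λ)
    R = k ℕ.* latticeHeight Λ
    open Points (quotient (R ℕ.+ R)) R
    A = frame ∘ rows
    ps = points A (const 0ℤ)
    embed : Vec ℤ J → Vec ℤ N
    embed c = Vec.tabulate (frame · Vec.lookup c)
    embed-injective : ∀ {c d} → embed c ≡ embed d → c ≡ d
    embed-injective {c} {d} eq = lookup-injective c d (frame-injective {X = frame} independent λ i →
      trans (sym (Vec.lookup∘tabulate (frame · Vec.lookup c) i))
        (trans (cong (λ x → Vec.lookup x i) eq) (Vec.lookup∘tabulate (frame · Vec.lookup d) i)))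
    bounded : ∀ {x} → x ∈ₗ List.map embed ps →
      Vec.lookup x ∈ carrier Λ × ∀ i → ∣ Vec.lookup x i ∣ ℕ.≤ J ℕ.* R
    bounded x∈ with ∈-map⁻ embed x∈
    ... | c , c∈ , refl =
        IsSubgroup.resp (Lattice.isSubgroup Λ) (sym ∘ Vec.lookup∘tabulate (frame · Vec.lookup c)) (closed (Vec.lookup c))
      , λ i → subst (λ z → ∣ z ∣ ℕ.≤ J ℕ.* R) (sym (Vec.lookup∘tabulate (frame · Vec.lookup c) i))
          (maximal-minor-bound frame rows triangular (trans maximal (sym height≡)) (subst (0 ℕ.<_) (sym height≡) height>0)
            (Vec.lookup c)
            (λ j → subst (λ z → ∣ z ∣ ℕ.≤ R) (ℤ.+-identityˡ ((frame · Vec.lookup c) (rows j)))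
              (∈-points⇒≤ (quotient-*-≤ (R ℕ.+ R)) A (const 0ℤ) triangular det≢0 c∈ j)) i)
    count : List.length (List.map embed ps) ℕ.* latticeHeight Λ ≡ (R ℕ.+ R) ℕ.^ J
    count = trans
      (cong₂ ℕ._*_ (trans (length-map embed ps) (length-points A (const 0ℤ))) (sym maximal))
      (weight-divisible R (R ℕ.+ R) A triangular det≢0
        (subst (ℕ._∣ R ℕ.+ R) (sym maximal) (ℕ.∣m∣n⇒∣m+n (ℕ.n∣m*n k) (ℕ.n∣m*n k))))

  -- Pigeonhole principle for lists, unions and maxima

  unique-⊆⇒length≤ : ∀ {A : Set} {xs ys : List A} → Unique xs → (∀ {x} → x ∈ₗ xs → x ∈ₗ ys) →
    List.length xs ℕ.≤ List.length ys
  unique-⊆⇒length≤ {xs = []}     []        xs⊆ys = ℕ.z≤n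
  unique-⊆⇒length≤ {xs = x ∷ xs} (x∉ ∷ unique) xs⊆ys with ∈-∃++ (xs⊆ys (here refl))
  ... | as , bs , refl = subst (suc (List.length xs) ℕ.≤_) count (ℕ.s≤s (unique-⊆⇒length≤ unique λ {y} y∈ →
          [ ∈-++⁺ˡ
          , (λ { (here refl) → contradiction refl (All.lookup x∉ y∈)
               ; (there y∈bs) → ∈-++⁺ʳ as y∈bs })
          ]′ (∈-++⁻ as (xs⊆ys (there y∈)))))
    where
    count : suc (List.length (as List.++ bs)) ≡ List.length (as List.++ x ∷ bs)
    count = trans (cong suc (length-++ as)) (trans (sym (ℕ.+-suc (List.length as) (List.length bs))) (sym (length-++ as)))

  fresh-element : ∀ {A : Set} → DecidableEquality A → ∀ {xs ys : List A} → Unique xs →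
    List.length ys ℕ.< List.length xs → ∃ λ x → x ∈ₗ xs × x ∉ₗ ys
  fresh-element _≟_ {xs} {ys} unique ys<xs with Any.any? (λ x → ¬? (x ∈? ys)) xs
    where open DecMembership _≟_ using (_∈?_)
  ... | yes fresh = find fresh
  ... | no ¬fresh = contradiction ys<xs (ℕ.≤⇒≯ (unique-⊆⇒length≤ unique λ {x} x∈ →
    decidable-stable (x ∈? ys) λ x∉ys → ¬fresh (lose x∈ x∉ys)))
    where
    open DecMembership _≟_ using (_∈?_)

  union : ∀ {A : Set} {M} → Vector (List A) M → List A
  union = Vector.foldr List._++_ []

  ∈-union⁺ : ∀ {A : Set} {M} (xss : Vector (List A) M) i {x} → x ∈ₗ xss i → x ∈ₗ union xss
  ∈-union⁺ xss zero    x∈ = ∈-++⁺ˡ x∈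
  ∈-union⁺ xss (suc i) x∈ = ∈-++⁺ʳ (xss zero) (∈-union⁺ (xss ∘ suc) i x∈)

  maximum≤ : ∀ {n} (v : Vector ℕ n) {B} → (∀ i → v i ℕ.≤ B) → maximum v ℕ.≤ B
  maximum≤ {zero}  v v≤B = ℕ.z≤n
  maximum≤ {suc n} v v≤B = ℕ.⊔-lub (v≤B zero) (maximum≤ (v ∘ suc) (v≤B ∘ suc))

open IntegerLattices
open import Data.Integer using (+_)
open import Data.Rational using (ℚ; _/_; _+_; _*_; _≤_; _<_)
open import Algebra.Properties.CommutativeSemiring.Exp (CommutativeRing.commutativeSemiring ℚ.+-*-commutativeRing)
  using (^-distrib-*)
open ℚ.+-*-Solver using (solve; con; _:=_; _:+_; _:*_)

-- The counting inequality over the rationals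

toℚᵘ-fromℕ : ∀ n → toℚᵘ (fromℕ n) ℚᵘ.≃ ℚᵘ.mkℚᵘ (+ n) 0
toℚᵘ-fromℕ n = ℚ.toℚᵘ-fromℚᵘ (ℚᵘ.mkℚᵘ (+ n) 0)

fromℕ-+ : ∀ m n → fromℕ (m ℕ.+ n) ≡ fromℕ m + fromℕ n
fromℕ-+ m n = ℚ.toℚᵘ-injective (ℚᵘ.≃-trans (toℚᵘ-fromℕ (m ℕ.+ n)) (ℚᵘ.≃-sym
  (ℚᵘ.≃-trans (ℚ.toℚᵘ-homo-+ (fromℕ m) (fromℕ n)) (ℚᵘ.≃-trans
    (ℚᵘ.+-cong (toℚᵘ-fromℕ m) (toℚᵘ-fromℕ n)) (ℚᵘ.*≡* (lemma (+ m) (+ n)))))))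
  where
  lemma : ∀ a b → (a ℤ.* ℤ.1ℤ ℤ.+ b ℤ.* ℤ.1ℤ) ℤ.* ℤ.1ℤ ≡ (a ℤ.+ b) ℤ.* ℤ.1ℤ
  lemma = ℤRing.solve-∀

fromℕ-* : ∀ m n → fromℕ (m ℕ.* n) ≡ fromℕ m * fromℕ n
fromℕ-* m n = ℚ.toℚᵘ-injective (ℚᵘ.≃-trans (toℚᵘ-fromℕ (m ℕ.* n)) (ℚᵘ.≃-sym
  (ℚᵘ.≃-trans (ℚ.toℚᵘ-homo-* (fromℕ m) (fromℕ n)) (ℚᵘ.≃-trans
    (ℚᵘ.*-cong (toℚᵘ-fromℕ m) (toℚᵘ-fromℕ n)) (ℚᵘ.*≡* (cong (ℤ._* ℤ.1ℤ) (sym (ℤ.pos-* m n))))))))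

fromℕ-^ : ∀ m n → fromℕ (m ℕ.^ n) ≡ fromℕ m ^ℚ n
fromℕ-^ m zero    = refl
fromℕ-^ m (suc n) = trans (fromℕ-* m (m ℕ.^ n)) (cong (fromℕ m *_) (fromℕ-^ m n))

0≤fromℕ : ∀ n → 0ℚ ≤ fromℕ n
0≤fromℕ n = ℚ.nonNegative⁻¹ (fromℕ n) {{ℚ.normalize-nonNeg n 1}}

p≤p+q : ∀ {p q} → 0ℚ ≤ q → p ≤ p + q
p≤p+q {p} {q} 0≤q = subst (_≤ p + q) (ℚ.+-identityʳ p) (ℚ.+-monoʳ-≤ p 0≤q)

fromℕ-mono-≤ : ∀ {m n} → m ℕ.≤ n → fromℕ m ≤ fromℕ n
fromℕ-mono-≤ {m} {n} m≤n = subst (fromℕ m ≤_)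
  (trans (sym (fromℕ-+ m (n ℕ.∸ m))) (cong fromℕ (ℕ.m+[n∸m]≡n m≤n))) (p≤p+q (0≤fromℕ (n ℕ.∸ m)))

0<fromℕ : ∀ {n} → 0 ℕ.< n → 0ℚ < fromℕ n
0<fromℕ 0<n = ℚ.<-≤-trans (ℚ.positive⁻¹ 1ℚ) (fromℕ-mono-≤ 0<n)

fromℕ-cancel-< : ∀ {m n} → fromℕ m < fromℕ n → m ℕ.< n
fromℕ-cancel-< m<n = ℕ.≰⇒> λ n≤m → ℚ.<-irrefl refl (ℚ.<-≤-trans m<n (fromℕ-mono-≤ n≤m))

fromℕ-recip : ∀ {n} → 0 ℕ.< n → fromℕ n * recip n ≡ 1ℚ
fromℕ-recip {suc n} _ = ℚ.toℚᵘ-injective (ℚᵘ.≃-trans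
  (ℚ.toℚᵘ-homo-* (fromℕ (suc n)) (recip (suc n))) (ℚᵘ.≃-trans
  (ℚᵘ.*-cong (toℚᵘ-fromℕ (suc n)) (ℚ.toℚᵘ-fromℚᵘ (ℚᵘ.mkℚᵘ (+ 1) n))) (ℚᵘ.*≡* (lemma (+ suc n)))))
  where
  lemma : ∀ a → a ℤ.* ℤ.1ℤ ℤ.* ℤ.1ℤ ≡ ℤ.1ℤ ℤ.* (ℤ.1ℤ ℤ.* a)
  lemma = ℤRing.solve-∀

0≤recip : ∀ n → 0ℚ ≤ recip n
0≤recip zero    = ℚ.≤-refl
0≤recip (suc n) = ℚ.nonNegative⁻¹ (recip (suc n)) {{ℚ.normalize-nonNeg 1 (suc n)}}

*-monoˡ : ∀ {p q r} → 0ℚ ≤ r → p ≤ q → p * r ≤ q * r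
*-monoˡ {r = r} 0≤r = ℚ.*-monoʳ-≤-nonNeg r {{ℚ.nonNegative 0≤r}}

*-monoʳ : ∀ {p q r} → 0ℚ ≤ r → p ≤ q → r * p ≤ r * q
*-monoʳ {r = r} 0≤r = ℚ.*-monoˡ-≤-nonNeg r {{ℚ.nonNegative 0≤r}}

*-mono : ∀ {p q r s} → 0ℚ ≤ p → 0ℚ ≤ s → p ≤ q → r ≤ s → p * r ≤ q * s
*-mono 0≤p 0≤s p≤q r≤s = ℚ.≤-trans (*-monoʳ 0≤p r≤s) (*-monoˡ 0≤s p≤q)

0≤+ : ∀ {p q} → 0ℚ ≤ p → 0ℚ ≤ q → 0ℚ ≤ p + q
0≤+ = ℚ.+-mono-≤

0≤* : ∀ {p q} → 0ℚ ≤ p → 0ℚ ≤ q → 0ℚ ≤ p * q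
0≤* {p} {q} 0≤p 0≤q = subst (_≤ p * q) (ℚ.*-zeroˡ q) (*-monoˡ 0≤q 0≤p)

0<* : ∀ {p q} → 0ℚ < p → 0ℚ < q → 0ℚ < p * q
0<* {p} {q} 0<p 0<q = subst (_< p * q) (ℚ.*-zeroˡ q) (ℚ.*-monoˡ-<-pos q {{ℚ.positive 0<q}} 0<p)

1≤* : ∀ {p q} → 1ℚ ≤ p → 1ℚ ≤ q → 1ℚ ≤ p * q
1≤* 1≤p 1≤q = *-mono (ℚ.nonNegative⁻¹ 1ℚ) (ℚ.≤-trans (ℚ.nonNegative⁻¹ 1ℚ) 1≤q) 1≤p 1≤q

1≤^ : ∀ {p} n → 1ℚ ≤ p → 1ℚ ≤ p ^ℚ n
1≤^ zero    1≤p = ℚ.≤-refl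
1≤^ (suc n) 1≤p = 1≤* 1≤p (1≤^ n 1≤p)

p≤q*p : ∀ {p q} → 0ℚ ≤ p → 1ℚ ≤ q → p ≤ q * p
p≤q*p {p} {q} 0≤p 1≤q = subst (_≤ q * p) (ℚ.*-identityˡ p) (*-monoˡ 0≤p 1≤q)

0≤∑ : ∀ {n} {f : Vector ℚ n} → (∀ i → 0ℚ ≤ f i) → 0ℚ ≤ ∑ℚ f
0≤∑ {zero}  0≤f = ℚ.≤-refl
0≤∑ {suc n} 0≤f = 0≤+ (0≤f zero) (0≤∑ (0≤f ∘ suc))

archimedean : ∀ p → ∃ λ n → p < fromℕ n
archimedean p@(ℚ.mkℚ a d-1 _) = suc ℤ.∣ a ∣ , ℚ.toℚᵘ-cancel-<
  (ℚᵘ.<-respʳ-≃ (ℚᵘ.≃-sym (toℚᵘ-fromℕ (suc ℤ.∣ a ∣))) (ℚᵘ.*<* (ℤ.≤-<-trans (i*1≤ a)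
    (ℤ.+<+ (ℕ.m≤m*n (suc ℤ.∣ a ∣) (suc d-1))))))
  where
  i*1≤ : ∀ a → a ℤ.* ℤ.1ℤ ℤ.≤ + ℤ.∣ a ∣
  i*1≤ a rewrite ℤ.*-identityʳ a with a
  ... | + n        = ℤ.≤-refl
  ... | ℤ.-[1+ n ] = ℤ.-≤+

-- The search descends from a known success. Both neighbours are used: the success makes the points
-- of Ω prevail, the failure bounds `k`.
first-success : ∀ {P : ℕ → Set} → (∀ n → Dec (P n)) → ¬ P 0 → ∀ n → P n → ∃ λ k → ¬ P k × P (suc k)
first-success P? ¬P0 zero    P0 = contradiction P0 ¬P0
first-success P? ¬P0 (suc n) Pn with P? n
... | yes Pn′ = first-success P? ¬P0 n Pn′
... | no ¬Pn  = n , ¬Pn , Pn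

-- The inequality that makes the points of Ω in a box of half-side k H(Ω)
-- outnumber those of the Λᵢ; a = 3J/2, j = J, c = a ^ (J - 2), m = M and s is
-- the sum of the reciprocal heights.
Outnumbers : (c j s m q : ℚ) → Set
Outnumbers c j s m q = c * ((q + q) * j * s + m) < (q + q) * (q + q)

-- The hypothesis forces `r` ≤ `q`, whence m ≤ r² ≤ 2q a r. Both terms on the left then share the
-- factor 2q, and what remains is a c (s + r), which is less than `q`.
outnumbers : ∀ {a c j s m q r} → 1ℚ ≤ a → j ≤ a → 1ℚ ≤ c → 0ℚ ≤ j → 0ℚ ≤ s → 0ℚ ≤ r → m ≤ r * r →
  a * c * (s + r) < q → Outnumbers c j s m q
outnumbers {a} {c} {j} {s} {m} {q} {r} 1≤a j≤a 1≤c 0≤j 0≤s 0≤r m≤rr w<q = begin-strict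
  c * ((q + q) * j * s + m)
    ≤⟨ *-monoʳ 0≤c (ℚ.+-mono-≤ (*-monoˡ 0≤s (*-monoʳ 0≤2q j≤a)) m≤) ⟩
  c * ((q + q) * a * s + (q + q) * a * r)
    ≡⟨ solve 5 (λ c q a s r → c :* ((q :+ q) :* a :* s :+ (q :+ q) :* a :* r) :=
         (q :+ q) :* (a :* c :* (s :+ r))) refl c q a s r ⟩
  (q + q) * (a * c * (s + r))
    <⟨ ℚ.*-monoʳ-<-pos (q + q) {{ℚ.positive (ℚ.+-mono-< 0<q 0<q)}} w<q ⟩
  (q + q) * q
    ≤⟨ *-monoʳ 0≤2q (p≤p+q 0≤q) ⟩
  (q + q) * (q + q) ∎
  where
  open ℚ.≤-Reasoning
  0≤1 = ℚ.nonNegative⁻¹ 1ℚ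
  0≤a = ℚ.≤-trans 0≤1 1≤a
  0≤c = ℚ.≤-trans 0≤1 1≤c
  0<q : 0ℚ < q
  0<q = ℚ.≤-<-trans (0≤* (0≤* 0≤a 0≤c) (0≤+ 0≤s 0≤r)) w<q
  0≤q = ℚ.<⇒≤ 0<q
  0≤2q = 0≤+ 0≤q 0≤q
  r≤q : r ≤ q
  r≤q = begin
    r               ≤⟨ p≤p+q 0≤s ⟩
    r + s           ≡⟨ ℚ.+-comm r s ⟩
    s + r           ≤⟨ p≤q*p (0≤+ 0≤s 0≤r) (1≤* 1≤a 1≤c) ⟩
    a * c * (s + r) ≤⟨ ℚ.<⇒≤ w<q ⟩
    q ∎
  m≤ : m ≤ (q + q) * a * r
  m≤ = begin
    m                 ≤⟨ m≤rr ⟩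
    r * r             ≤⟨ *-monoˡ 0≤r (ℚ.≤-trans r≤q (p≤p+q 0≤q)) ⟩
    (q + q) * r       ≤⟨ *-monoˡ 0≤r (p≤q*p 0≤2q 1≤a) ⟩
    a * (q + q) * r   ≡⟨ cong (_* r) (ℚ.*-comm a (q + q)) ⟩
    (q + q) * a * r ∎

-- Dividing the i-th hypothesis by `H i` gives at most (t / H i + 1) p elements; the ones add up to
-- M.
union-bound : ∀ {A : Set} {M} (xss : Vector (List A) M) (H : Vector ℕ M) t p → (∀ i → 0 ℕ.< H i) →
  (∀ i → List.length (xss i) ℕ.* H i ℕ.≤ (t ℕ.+ H i) ℕ.* p) →
  fromℕ (List.length (union xss)) ≤ (fromℕ t * ∑ℚ (recip ∘ H) + fromℕ M) * fromℕ p
union-bound {M = zero}  xss H t p H>0 bound =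
  0≤* (0≤+ (0≤* (0≤fromℕ t) ℚ.≤-refl) ℚ.≤-refl) (0≤fromℕ p)
union-bound {M = suc M} xss H t p H>0 bound = begin
  fromℕ (List.length (union xss))
    ≡⟨ trans (cong fromℕ (length-++ (xss zero))) (fromℕ-+ F (List.length (union (xss ∘ suc)))) ⟩
  fromℕ F + fromℕ (List.length (union (xss ∘ suc)))
    ≤⟨ ℚ.+-mono-≤ first (union-bound (xss ∘ suc) (H ∘ suc) t p (H>0 ∘ suc) (bound ∘ suc)) ⟩
  (fromℕ t * recip h + 1ℚ) * fromℕ p + (fromℕ t * S + fromℕ M) * fromℕ p
    ≡⟨ solve 5 (λ t h s m p → (t :* h :+ con 1ℚ) :* p :+ (t :* s :+ m) :* p :=
         (t :* (h :+ s) :+ (con 1ℚ :+ m)) :* p) refl (fromℕ t) (recip h) S (fromℕ M) (fromℕ p) ⟩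
  (fromℕ t * (recip h + S) + (1ℚ + fromℕ M)) * fromℕ p
    ≡⟨ cong (λ m → (fromℕ t * (recip h + S) + m) * fromℕ p) (fromℕ-+ 1 M) ⟨
  (fromℕ t * (recip h + S) + fromℕ (suc M)) * fromℕ p ∎
  where
  open ℚ.≤-Reasoning
  F = List.length (xss zero)
  h = H zero
  S = ∑ℚ (recip ∘ H ∘ suc)
  first : fromℕ F ≤ (fromℕ t * recip h + 1ℚ) * fromℕ p
  first = begin
    fromℕ F
      ≡⟨ trans (cong (fromℕ F *_) (fromℕ-recip (H>0 zero))) (ℚ.*-identityʳ (fromℕ F)) ⟨
    fromℕ F * (fromℕ h * recip h)
      ≡⟨ trans (cong (_* recip h) (fromℕ-* F h)) (ℚ.*-assoc (fromℕ F) (fromℕ h) (recip h)) ⟨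
    fromℕ (F ℕ.* h) * recip h
      ≤⟨ *-monoˡ (0≤recip h) (fromℕ-mono-≤ (bound zero)) ⟩
    fromℕ ((t ℕ.+ h) ℕ.* p) * recip h
      ≡⟨ cong (_* recip h) (trans (fromℕ-* (t ℕ.+ h) p) (cong (_* fromℕ p) (fromℕ-+ t h))) ⟩
    (fromℕ t + fromℕ h) * fromℕ p * recip h
      ≡⟨ solve 4 (λ t h p i → (t :+ h) :* p :* i := (t :* i :+ h :* i) :* p) refl
           (fromℕ t) (fromℕ h) (fromℕ p) (recip h) ⟩
    (fromℕ t * recip h + fromℕ h * recip h) * fromℕ p
      ≡⟨ cong (λ x → (fromℕ t * recip h + x) * fromℕ p) (fromℕ-recip (H>0 zero)) ⟩
    (fromℕ t * recip h + 1ℚ) * fromℕ p ∎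

-- After multiplication by `D`, both sides contain D² (2kD)^(J-2), and cancelling it leaves exactly
-- `Outnumbers`.
fewer-than-candidates : ∀ n k D {c F L s m} → 0 ℕ.< k → 0 ℕ.< D → let J = suc (suc n); T = J ℕ.* (k ℕ.* D) in
  c ≡ (+ 3 / 2 * fromℕ J) ^ℚ n → 0ℚ ≤ s → 0ℚ ≤ m → Outnumbers c (fromℕ J) s m (fromℕ k) →
  fromℕ F ≤ (fromℕ (T ℕ.+ T) * s + m) * fromℕ (suc (T ℕ.+ T) ℕ.^ n) →
  L ℕ.* D ≡ (k ℕ.* D ℕ.+ k ℕ.* D) ℕ.^ J → F ℕ.< L
fewer-than-candidates n k D {c} {F} {L} {s} {m} 0<k 0<D refl 0≤s 0≤m more F≤ LD≡ =
  ℕ.*-cancelʳ-< D F L (fromℕ-cancel-< (begin-strict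
    fromℕ (F ℕ.* D)
      ≡⟨ fromℕ-* F D ⟩
    fromℕ F * d
      ≤⟨ *-monoˡ 0≤d F≤ ⟩
    (fromℕ (T ℕ.+ T) * s + m) * fromℕ (suc (T ℕ.+ T) ℕ.^ n) * d
      ≤⟨ *-monoˡ 0≤d (*-mono (0≤+ (0≤* (0≤fromℕ (T ℕ.+ T)) 0≤s) 0≤m) (0≤* 0≤c (0≤fromℕ (U ℕ.^ n))) linear power) ⟩
    d * ((q + q) * j * s + m) * (c * y) * d
      ≡⟨ solve 4 (λ d x c y → d :* x :* (c :* y) :* d := d :* d :* y :* (c :* x)) refl d ((q + q) * j * s + m) c y ⟩
    d * d * y * (c * ((q + q) * j * s + m))
      <⟨ ℚ.*-monoʳ-<-pos (d * d * y) {{ℚ.positive (0<* (0<* 0<d 0<d) 0<y)}} more ⟩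
    d * d * y * ((q + q) * (q + q))
      ≡⟨ solve 3 (λ d q y → d :* d :* y :* ((q :+ q) :* (q :+ q)) :=
           (q :* d :+ q :* d) :* ((q :* d :+ q :* d) :* y)) refl d q y ⟩
    (q * d + q * d) * ((q * d + q * d) * y)
      ≡⟨ cong (λ u → u * (u * y)) U≡ ⟨
    fromℕ U * (fromℕ U * y)
      ≡⟨ trans (fromℕ-* U (U ℕ.* U ℕ.^ n)) (cong (fromℕ U *_) (fromℕ-* U (U ℕ.^ n))) ⟨
    fromℕ (U ℕ.^ J)
      ≡⟨ cong fromℕ LD≡ ⟨
    fromℕ (L ℕ.* D) ∎))
  where
  open ℚ.≤-Reasoning
  J = suc (suc n)
  T = J ℕ.* (k ℕ.* D)
  U = k ℕ.* D ℕ.+ k ℕ.* D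
  d = fromℕ D
  j = fromℕ J
  q = fromℕ k
  y = fromℕ (U ℕ.^ n)
  0<kD = ℕ.*-mono-≤ 0<k 0<D
  0<d = 0<fromℕ 0<D
  0≤d = 0≤fromℕ D
  0<y : 0ℚ < y
  0<y = 0<fromℕ (ℕ.m^n>0 U {{ℕ.>-nonZero (ℕ.≤-trans 0<kD (ℕ.m≤m+n (k ℕ.* D) _))}} n)
  1≤a : 1ℚ ≤ + 3 / 2 * j
  1≤a = 1≤* {+ 3 / 2} (ℚ.≤ᵇ⇒≤ _) (fromℕ-mono-≤ {1} {J} (ℕ.s≤s ℕ.z≤n))
  0≤c : 0ℚ ≤ c
  0≤c = ℚ.≤-trans (ℚ.nonNegative⁻¹ 1ℚ) (1≤^ n 1≤a)
  U≡ : fromℕ U ≡ q * d + q * d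
  U≡ = trans (fromℕ-+ (k ℕ.* D) (k ℕ.* D)) (cong (λ x → x + x) (fromℕ-* k D))
  T≡ : fromℕ (T ℕ.+ T) ≡ j * (q * d) + j * (q * d)
  T≡ = trans (fromℕ-+ T T) (cong (λ x → x + x) (trans (fromℕ-* J (k ℕ.* D)) (cong (j *_) (fromℕ-* k D))))
  linear : fromℕ (T ℕ.+ T) * s + m ≤ d * ((q + q) * j * s + m)
  linear = begin
    fromℕ (T ℕ.+ T) * s + m
      ≤⟨ ℚ.+-monoʳ-≤ (fromℕ (T ℕ.+ T) * s) (p≤q*p 0≤m (fromℕ-mono-≤ 0<D)) ⟩
    fromℕ (T ℕ.+ T) * s + d * m
      ≡⟨ cong (λ t → t * s + d * m) T≡ ⟩
    (j * (q * d) + j * (q * d)) * s + d * m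
      ≡⟨ solve 5 (λ j q d s m → (j :* (q :* d) :+ j :* (q :* d)) :* s :+ d :* m :=
           d :* ((q :+ q) :* j :* s :+ m)) refl j q d s m ⟩
    d * ((q + q) * j * s + m) ∎
  -- This uses `T` ≥ 1; as 3T = (3J/2) `U`, it is the source of the constant 3/2.
  2T<3T : suc (T ℕ.+ T) ℕ.≤ 3 ℕ.* T
  2T<3T = subst (suc (T ℕ.+ T) ℕ.≤_) (lemma T) (ℕ.+-monoˡ-≤ (T ℕ.+ T) (ℕ.*-mono-≤ {1} {J} (ℕ.s≤s ℕ.z≤n) 0<kD))
    where
    lemma : ∀ t → t ℕ.+ (t ℕ.+ t) ≡ 3 ℕ.* t
    lemma = ℕRing.solve-∀
  power : fromℕ (suc (T ℕ.+ T) ℕ.^ n) ≤ c * y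
  power = begin
    fromℕ (suc (T ℕ.+ T) ℕ.^ n)
      ≤⟨ fromℕ-mono-≤ (ℕ.^-monoˡ-≤ n 2T<3T) ⟩
    fromℕ ((3 ℕ.* T) ℕ.^ n)
      ≡⟨ fromℕ-^ (3 ℕ.* T) n ⟩
    fromℕ (3 ℕ.* T) ^ℚ n
      ≡⟨ cong (_^ℚ n) 3T≡ ⟩
    (+ 3 / 2 * j * fromℕ U) ^ℚ n
      ≡⟨ ^-distrib-* (+ 3 / 2 * j) (fromℕ U) n ⟩
    c * fromℕ U ^ℚ n
      ≡⟨ cong (c *_) (fromℕ-^ U n) ⟨
    c * y ∎
    where
    3T≡ : fromℕ (3 ℕ.* T) ≡ + 3 / 2 * j * fromℕ U
    3T≡ = begin-equality
      fromℕ (3 ℕ.* T)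
        ≡⟨ trans (fromℕ-* 3 T) (cong (fromℕ 3 *_) (trans (fromℕ-* J (k ℕ.* D)) (cong (j *_) (fromℕ-* k D)))) ⟩
      fromℕ 3 * (j * (q * d))
        ≡⟨ solve 3 (λ j q d → con (fromℕ 3) :* (j :* (q :* d)) :=
             con (+ 3 / 2) :* j :* (q :* d :+ q :* d)) refl j q d ⟩
      + 3 / 2 * j * (q * d + q * d)
        ≡⟨ cong (+ 3 / 2 * j *_) U≡ ⟨
      + 3 / 2 * j * fromℕ U ∎

theorem1p1 : ∀ (N J M : ℕ) → 1 ℕ.≤ J → J ℕ.≤ N → 1 ℕ.≤ M →
    (Ω : Lattice N J) →
    (l : Fin M → ℕ) (Λ : (i : Fin M) → Lattice N (l i)) →
    (∀ i → carrier (Λ i) ⊆ carrier Ω) →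
    (∀ i → 1 ℕ.≤ l i × l i ℕ.≤ J ℕ.∸ 1) →
    ∃ λ x →
    x ∈ carrier Ω ×
    (∀ i → x ∉ carrier (Λ i)) ×
    (∀ (r : ℚ) → √ M ≤ r →
    fromℕ (height x) ≤
    ((+ 3 / 2) ^ℚ (J ℕ.∸ 1) * fromℕ (J ℕ.^ J)
    * (∑ℚ (λ i → recip (latticeHeight (Λ i))) + r)
    + fromℕ J)
    * fromℕ (latticeHeight Ω))
theorem1p1 N zero M () J≤N 1≤M Ω l Λ Λ⊆Ω rank
-- For J = 1 the first of the Λᵢ would have rank at least 1 and at most 0.
theorem1p1 N (suc zero) (suc M) 1≤J J≤N 1≤M Ω l Λ Λ⊆Ω rank =
  contradiction (ℕ.≤-trans (proj₁ (rank zero)) (proj₂ (rank zero))) λ ()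
theorem1p1 N J@(suc (suc n)) M@(suc _) 1≤J J≤N 1≤M Ω l Λ Λ⊆Ω rank =
  Vec.lookup x , proj₁ (bounded x∈) , avoids , bound
  where
  D = latticeHeight Ω
  H = latticeHeight ∘ Λ
  H>0 : ∀ i → 0 ℕ.< H i
  H>0 i = TriangularFrame.height>0 (triangular-frame (Λ i))
  0<D = TriangularFrame.height>0 (triangular-frame Ω)
  j = fromℕ J
  m = fromℕ M
  S = ∑ℚ (recip ∘ H)
  a = + 3 / 2 * j
  c = a ^ℚ n
  0≤S : 0ℚ ≤ S
  0≤S = 0≤∑ (0≤recip ∘ H)
  1≤j : 1ℚ ≤ j
  1≤j = fromℕ-mono-≤ {1} {J} (ℕ.s≤s ℕ.z≤n)
  1≤3/2 : 1ℚ ≤ + 3 / 2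
  1≤3/2 = ℚ.≤ᵇ⇒≤ _
  1≤a : 1ℚ ≤ a
  1≤a = 1≤* 1≤3/2 1≤j
  0≤c : 0ℚ ≤ c
  0≤c = ℚ.≤-trans (ℚ.nonNegative⁻¹ 1ℚ) (1≤^ n 1≤a)
  enough : ∀ {r q} → 0ℚ ≤ r → m ≤ r * r → a * c * (S + r) < q → Outnumbers c j S m q
  enough = outnumbers 1≤a (p≤q*p (0≤fromℕ J) 1≤3/2) (1≤^ n 1≤a) (0≤fromℕ J) 0≤S
  -- Any rational bound for √M yields some success; M itself is one, since M ≤ M² for M ≥ 1.
  large = archimedean (a * c * (S + m))
  least : ∃ λ k → ¬ Outnumbers c j S m (fromℕ k) × Outnumbers c j S m (fromℕ (suc k))
  least = first-success (λ k → _ ℚ.<? _)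
    -- At 0 the right side of `Outnumbers` is 0, and the left side is never negative.
    (λ more → ℚ.<-irrefl refl (ℚ.≤-<-trans
      (0≤* 0≤c (0≤+ (0≤* (0≤* (0≤+ {0ℚ} {0ℚ} ℚ.≤-refl ℚ.≤-refl) (0≤fromℕ J)) 0≤S) (0≤fromℕ M))) more))
    (proj₁ large)
    (enough (0≤fromℕ M) (p≤q*p (0≤fromℕ M) (fromℕ-mono-≤ 1≤M)) (proj₂ large))
  k = proj₁ least
  T = J ℕ.* (suc k ℕ.* D)
  candidates = lattice-points Ω (suc k)
  bounded : ∀ {x} → x ∈ₗ proj₁ candidates → _
  bounded = proj₁ (proj₂ (proj₂ candidates))
  covers = λ i → lattice-cover (Λ i) T
  forbidden = λ i → proj₁ (covers i)
  count : ∀ i → List.length (forbidden i) ℕ.* H i ℕ.≤ (T ℕ.+ T ℕ.+ H i) ℕ.* suc (T ℕ.+ T) ℕ.^ n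
  -- The rank is first raised to J - 1; then the spare factor of the cover bound lowers the exponent
  -- to J - 2.
  count i = ℕ.*-cancelʳ-≤ _ _ (suc (T ℕ.+ T)) (begin
    List.length (forbidden i) ℕ.* H i ℕ.* suc (T ℕ.+ T)
      ≤⟨ proj₂ (proj₂ (covers i)) ⟩
    (T ℕ.+ T ℕ.+ H i) ℕ.* suc (T ℕ.+ T) ℕ.^ l i
      ≤⟨ ℕ.*-monoʳ-≤ (T ℕ.+ T ℕ.+ H i) (ℕ.^-monoʳ-≤ (suc (T ℕ.+ T)) (proj₂ (rank i))) ⟩
    (T ℕ.+ T ℕ.+ H i) ℕ.* (suc (T ℕ.+ T) ℕ.* suc (T ℕ.+ T) ℕ.^ n)
      ≡⟨ lemma (T ℕ.+ T ℕ.+ H i) (suc (T ℕ.+ T)) (suc (T ℕ.+ T) ℕ.^ n) ⟩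
    (T ℕ.+ T ℕ.+ H i) ℕ.* suc (T ℕ.+ T) ℕ.^ n ℕ.* suc (T ℕ.+ T) ∎)
    where
    open ℕ.≤-Reasoning
    lemma : ∀ x y z → x ℕ.* (y ℕ.* z) ≡ x ℕ.* z ℕ.* y
    lemma = ℕRing.solve-∀
  fewer : List.length (union forbidden) ℕ.< List.length (proj₁ candidates)
  fewer = fewer-than-candidates n (suc k) D (ℕ.s≤s ℕ.z≤n) 0<D refl 0≤S (0≤fromℕ M) (proj₂ (proj₂ least))
    (union-bound forbidden H (T ℕ.+ T) (suc (T ℕ.+ T) ℕ.^ n) H>0 count)
    (proj₂ (proj₂ (proj₂ candidates)))
  fresh = fresh-element (Vec.≡-dec ℤ._≟_) (proj₁ (proj₂ candidates)) fewer
  x = proj₁ fresh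
  x∈ = proj₁ (proj₂ fresh)
  avoids : ∀ i → Vec.lookup x ∉ carrier (Λ i)
  avoids i x∈Λ = proj₂ (proj₂ fresh) (∈-union⁺ forbidden i
    (subst (_∈ₗ forbidden i) (Vec.tabulate∘lookup x) (proj₁ (proj₂ (covers i)) x∈Λ (proj₂ (bounded x∈)))))
  bound : ∀ (r : ℚ) → √ M ≤ r → fromℕ (height (Vec.lookup x)) ≤
    ((+ 3 / 2) ^ℚ suc n * fromℕ (J ℕ.^ J) * (S + r) + j) * fromℕ D
  bound r (0≤r , m≤rr) = begin
    fromℕ (height (Vec.lookup x))
      ≤⟨ fromℕ-mono-≤ (maximum≤ _ (proj₂ (bounded x∈))) ⟩
    fromℕ T
      ≡⟨ trans (fromℕ-* J (suc k ℕ.* D)) (cong (j *_) (trans (fromℕ-* (suc k) D) (cong (_* fromℕ D) (fromℕ-+ 1 k)))) ⟩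
    j * ((1ℚ + fromℕ k) * fromℕ D)
      -- By contraposition of `enough`, the failure at `k` gives `k` ≤ a c (S + r) for the present
      -- `r`; the summand 1 becomes the final + J.
      ≤⟨ *-monoʳ (0≤fromℕ J) (*-monoˡ (0≤fromℕ D) (ℚ.+-monoʳ-≤ 1ℚ
           (ℚ.≮⇒≥ (proj₁ (proj₂ least) ∘ enough {r} {fromℕ k} 0≤r m≤rr)))) ⟩
    j * ((1ℚ + a * c * (S + r)) * fromℕ D)
      ≡⟨ solve 4 (λ j b z d → j :* ((con 1ℚ :+ b :* z) :* d) := (j :* b :* z :+ j) :* d) refl j (a * c) (S + r) (fromℕ D) ⟩
    (j * (a * c) * (S + r) + j) * fromℕ D
      ≡⟨ cong (λ b → (b * (S + r) + j) * fromℕ D) constant ⟩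
    ((+ 3 / 2) ^ℚ suc n * fromℕ (J ℕ.^ J) * (S + r) + j) * fromℕ D ∎
    where
    open ℚ.≤-Reasoning
    constant : j * (a ^ℚ suc n) ≡ (+ 3 / 2) ^ℚ suc n * fromℕ (J ℕ.^ J)
    constant = begin-equality
      j * (a ^ℚ suc n)
        ≡⟨ cong (j *_) (^-distrib-* (+ 3 / 2) j (suc n)) ⟩
      j * ((+ 3 / 2) ^ℚ suc n * j ^ℚ suc n)
        ≡⟨ solve 3 (λ x y z → x :* (y :* z) := y :* (x :* z)) refl j ((+ 3 / 2) ^ℚ suc n) (j ^ℚ suc n) ⟩
      (+ 3 / 2) ^ℚ suc n * (j * j ^ℚ suc n)
        ≡⟨ cong ((+ 3 / 2) ^ℚ suc n *_) (fromℕ-^ J J) ⟨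
      (+ 3 / 2) ^ℚ suc n * fromℕ (J ℕ.^ J) ∎
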